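{- Let $G$ be a bipartite graph with bipartition $(X,Y)$ and let $L$ be the set function given by $L(x)=\{ -1,1\}$ for $x\in X$ and $L(y)=\{0,2,3,4,\dots\}$ for $y\in Y$. Then $G$ contains an $L$-factor if and only if for every subset $S\subseteq X$ we have $q(G-S)\leq |S|$, where $q(G-S)$ denotes the number of components $R$ of $G-S$ that are $L$-critical.
   Context: Graphs are finite and simple. For any subgraph $K$ of $G$, $L$ is defined on $V(K)$ by the same rule ($\{ -1,1\}$ on vertices in $X$, $\{0,2,3,\dots\}$ on vertices in $Y$). An $L$-factor of $K$ is a spanning subgraph $F$ with $d_F(v)\in L(v)$ for all $v\in V(K)$ (for $G$ this is exactly a spanning subgraph with $d_F(x)=1$ for $x\in X$ and $d_F(y)\neq1$ for $y\in Y$). For a spanning subgraph $F$ of $K$, $\nabla_L(F;K)=\sum_{v\in V(K)}\min\{|d_F(v)-h|: h\in L(v)\}$, $\nabla_L(K)=\min_F\nabla_L(F;K)$; $F$ is $L$-optimal if it attains this minimum. $I_L(v)=\{d_F(v): F\ L\text{ -optimal}\}$. $C_L=\{v: I_L(v)\subseteq L(v)\}$, $A_L=\{v\notin C_L:\min I_L(v)\ge\max L(v)\}$, $B_L=\{v\notin C_L:\max I_L(v)\le\min L(v)\}$, $D_L=V(K)\setminus(A_L\cup B_L\cup C_L)$, with $\max L(y)=+\infty$ for $y\in Y$. $K$ is $L$-critical if $K$ is connected and $D_L=V(K)$. -}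

module Defs where

open import Data.Nat using (ℕ; zero; suc; _+_; _⊓_; _≤_) renaming (_≡ᵇ_ to _≡ᵇℕ_)
open import Data.Integer as ℤ using (ℤ; +_; -[1+_]; ∣_∣) renaming (_≤_ to _≤ℤ_; _-_ to _-ℤ_)
open import Data.Fin using (Fin; zero; suc)
open import Data.Bool using (Bool; true; false; if_then_else_; not)
open import Data.Product using (Σ; ∃; _×_; _,_)
open import Data.Sum using (_⊎_)
open import Data.Empty using (⊥)
open import Relation.Binary.PropositionalEquality using (_≡_; _≢_)
open import Relation.Nullary using (¬_)

record Graph (n : ℕ) : Set where
  field
    adj   : Fin n → Fin n → Bool
    sym   : ∀ u v → adj u v ≡ adj v u
    irrefl : ∀ v → adj v v ≡ false
open Graph public

-- Bipartite graph with bipartition (X , Y): side v ≡ true  means v ∈ X,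
-- side v ≡ false means v ∈ Y; every edge joins X and Y.
IsBipartition : ∀ {n} → Graph n → (Fin n → Bool) → Set
IsBipartition G side = ∀ u v → adj G u v ≡ true → side u ≢ side v

count : ∀ {n} → (Fin n → Bool) → ℕ
count {zero}  P = 0
count {suc n} P = (if P zero then 1 else 0) + count (λ i → P (suc i))

sumFin : ∀ {n} → (Fin n → ℕ) → ℕ
sumFin {zero}  f = 0
sumFin {suc n} f = f zero + sumFin (λ i → f (suc i))

data Path {n} (G : Graph n) (W : Fin n → Bool) : Fin n → Fin n → Set where
  here : ∀ {v} → W v ≡ true → Path G W v v
  step : ∀ {u w v} → W u ≡ true → adj G u w ≡ true → Path G W w v → Path G W u v

Connected : ∀ {n} → Graph n → (Fin n → Bool) → Set
Connected G W = (∃ λ v → W v ≡ true) ×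
  (∀ u v → W u ≡ true → W v ≡ true → Path G W u v)

IsComponent : ∀ {n} → Graph n → (Fin n → Bool) → (Fin n → Bool) → Set
IsComponent G W R =
  (∀ v → R v ≡ true → W v ≡ true) ×
  Connected G R ×
  (∀ u w → R u ≡ true → W w ≡ true → adj G u w ≡ true → R w ≡ true)

minus : ∀ {n} → (Fin n → Bool) → (Fin n → Bool)
minus S v = not (S v)

record Spanning {n} (G : Graph n) (W : Fin n → Bool) : Set where
  field
    edge    : Fin n → Fin n → Bool
    esym    : ∀ u v → edge u v ≡ edge v u
    sub     : ∀ u v → edge u v ≡ true →
              (adj G u v ≡ true) × (W u ≡ true) × (W v ≡ true)
open Spanning public

deg : ∀ {n} {G : Graph n} {W : Fin n → Bool} → Spanning G W → Fin n → ℕ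
deg F v = count (edge F v)

inL : Bool → ℤ → Set
inL true  h = (h ≡ -[1+ 0 ]) ⊎ (h ≡ + 1)
inL false h = (h ≡ + 0) ⊎ (+ 2 ≤ℤ h)

-- "min I ≥ max L(v)" for a degree d:  max L(x) = 1,  max L(y) = +∞
geMaxL : Bool → ℤ → Set
geMaxL true  d = + 1 ≤ℤ d
geMaxL false d = ⊥

-- "max I ≤ min L(v)" for a degree d:  min L(x) = -1,  min L(y) = 0
leMinL : Bool → ℤ → Set
leMinL true  d = d ≤ℤ -[1+ 0 ]
leMinL false d = d ≤ℤ + 0

-- min { |d - h| : h ∈ L(v) }.  For X this is literally min(|d+1|,|d-1|);
-- for Y (infinite set {0,2,3,...}) the minimum over d ∈ ℕ equals 1 if d = 1
-- and 0 otherwise.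
defic : Bool → ℕ → ℕ
defic true  d = ∣ + d -ℤ -[1+ 0 ] ∣ ⊓ ∣ + d -ℤ + 1 ∣
defic false d = if d ≡ᵇℕ 1 then 1 else 0

module _ {n : ℕ} (G : Graph n) (side : Fin n → Bool) (W : Fin n → Bool) where

  nabla : Spanning G W → ℕ
  nabla F = sumFin (λ v → if W v then defic (side v) (deg F v) else 0)

  Optimal : Spanning G W → Set
  Optimal F = ∀ F' → nabla F ≤ nabla F'

  InC : Fin n → Set
  InC v = ∀ F → Optimal F → inL (side v) (+ deg F v)

  InA : Fin n → Set
  InA v = ¬ InC v × (∀ F → Optimal F → geMaxL (side v) (+ deg F v))

  InB : Fin n → Set
  InB v = ¬ InC v × (∀ F → Optimal F → leMinL (side v) (+ deg F v))

  InD : Fin n → Set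
  InD v = ¬ InA v × ¬ InB v × ¬ InC v

  LCritical : Set
  LCritical = Connected G W × (∀ v → W v ≡ true → InD v)

full : ∀ {n} → Fin n → Bool
full _ = true

HasLFactor : ∀ {n} → Graph n → (Fin n → Bool) → Set
HasLFactor G side =
  Σ (Spanning G full) λ F → ∀ v → inL (side v) (+ deg F v)

-- q(G - S) ≤ k : every family of pairwise distinct L-critical components
-- of G - S has at most k members.
QAtMost : ∀ {n} → Graph n → (Fin n → Bool) → (Fin n → Bool) → ℕ → Set
QAtMost {n} G side S k =
  ∀ (m : ℕ) (R : Fin m → Fin n → Bool) →
  (∀ i j → i ≢ j → ∃ λ v → R i v ≢ R j v) →
  (∀ i → IsComponent G (minus S) (R i) × LCritical G side (R i)) →
  m ≤ k

{-# OPTIONS --safe #-}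
-- An L-factor amounts to a map sending every x ∈ X to a neighbour so that no y is hit exactly once; a
-- packing is a partial map of this kind.  The sets that packings can cover are the independent sets of
-- a matroid (exchange).  Call x exposed if some maximum packing misses it.
--
-- If there is no L-factor, move into T ⊆ X, one at a time, the unexposed vertices of X ∖ T that share
-- a neighbour with an exposed one.  Each move lowers the maximum size of a packing by at least 2
-- (stability), so in the end every maximum packing M of G − T misses more than |T| vertices.  Now
-- exposure is constant on the components of G − T, and, "missed together by no maximum packing" being
-- transitive (series-trans), M misses at most one vertex of each component (Gallai's lemma).  A
-- component R with a missed vertex has no L-factor, since that would enlarge M, while R − x has one
-- for every x ∈ X ∩ R; adding an edge at x then yields optimal subgraphs in which a given y has
-- degree 1, so R is L-critical.
--
-- Conversely an L-critical component of G − S has no L-factor, so an L-factor of G joins it to S,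
-- and the vertices of S have degree 1.
module Submission where

open import Defs
open import Data.Nat using (ℕ; zero; suc; pred; _+_; _≤_; _<_; z≤n; s≤s; s≤s⁻¹)
open import Data.Nat.Properties hiding (_≟_; suc-injective)
open import Data.Nat.Induction using (<-wellFounded)
open import Data.Nat.Solver using (module +-*-Solver)
open import Data.Integer using (ℤ; +≤+) renaming (+_ to pos)
open import Data.Fin using (Fin; zero; suc)
open import Data.Fin.Properties using (_≟_; any?; all?; suc-injective)
open import Data.Bool using (Bool; true; false; if_then_else_; not; _∧_; _∨_)
import Data.Bool.Properties as Bool
open import Data.Maybe using (Maybe; just; nothing; is-just)
import Data.Maybe.Properties as Maybe
open import Data.Vec using (Vec; []; _∷_; lookup; tabulate; replicate)
open import Data.Vec.Properties using (lookup∘tabulate; lookup-replicate)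
open import Data.Product using (∃; _×_; _,_; proj₁; proj₂)
open import Data.Sum using (_⊎_; inj₁; inj₂; [_,_]′)
open import Data.Empty using (⊥; ⊥-elim)
open import Function using (_∘_; const)
open import Function.Bundles using (_⇔_; mk⇔)
open import Function.Definitions using (Injective)
open import Induction.WellFounded using (Acc; acc)
open import Relation.Binary.PropositionalEquality
  using (_≡_; _≢_; refl; trans; cong; cong₂; subst; ≢-sym) renaming (sym to ≡-sym)
open import Relation.Nullary using (¬_; Dec; yes; no; does; contradiction)
open import Relation.Nullary.Decidable
  using (dec-true; dec-false; does-⇔; map′; _×-dec_; _⊎-dec_; _→-dec_; ¬?)

-- Boolean subsets of Fin n and their cardinality

infix 4 _∈_ _∉_ _⊆_
infixl 6 _∪_ _∖_

_∈_ _∉_ : ∀ {n} → Fin n → (Fin n → Bool) → Set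
x ∈ P = P x ≡ true
x ∉ P = P x ≡ false

_⊆_ : ∀ {n} → (Fin n → Bool) → (Fin n → Bool) → Set
P ⊆ Q = ∀ x → x ∈ P → x ∈ Q

_∪_ _∖_ : ∀ {n} → (Fin n → Bool) → (Fin n → Bool) → Fin n → Bool
(P ∪ Q) x = P x ∨ Q x
(P ∖ Q) x = P x ∧ not (Q x)

∅ : ∀ {n} → Fin n → Bool
∅ _ = false

does-true : ∀ {A : Set} (a? : Dec A) → does a? ≡ true → A
does-true (yes a) _ = a

∈∉⇒⊥ : ∀ {b} → b ≡ true → b ≡ false → ⊥
∈∉⇒⊥ refl ()

module _ {n : ℕ} where

  infix 4 _∈?_
  _∈?_ : ∀ (x : Fin n) P → Dec (x ∈ P)
  x ∈? P = P x Bool.≟ true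

  ∈-or-∉ : ∀ (P : Fin n → Bool) x → x ∈ P ⊎ x ∉ P
  ∈-or-∉ P x with P x
  ... | true  = inj₁ refl
  ... | false = inj₂ refl

  module _ (P Q : Fin n → Bool) {x : Fin n} where

    ∈-∪ˡ : x ∈ P → x ∈ P ∪ Q
    ∈-∪ˡ x∈P rewrite x∈P = refl

    ∈-∪ʳ : x ∈ Q → x ∈ P ∪ Q
    ∈-∪ʳ x∈Q rewrite x∈Q = Bool.∨-zeroʳ (P x)

    ∈-∪⁻ : x ∈ P ∪ Q → x ∈ P ⊎ x ∈ Q
    ∈-∪⁻ h with P x
    ... | true  = inj₁ refl
    ... | false = inj₂ h

    ∉-∪ : x ∉ P → x ∉ Q → x ∉ P ∪ Q
    ∉-∪ x∉P x∉Q rewrite x∉P = x∉Q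

    ∈-∖ : x ∈ P → x ∉ Q → x ∈ P ∖ Q
    ∈-∖ x∈P x∉Q rewrite x∈P | x∉Q = refl

    ∈-∖⁻ : x ∈ P ∖ Q → x ∈ P × x ∉ Q
    ∈-∖⁻ h with P x | Q x
    ... | true | false = refl , refl

    ∉-∖ˡ : x ∉ P → x ∉ P ∖ Q
    ∉-∖ˡ x∉P rewrite x∉P = refl

    ∉-∖ʳ : x ∈ Q → x ∉ P ∖ Q
    ∉-∖ʳ x∈Q rewrite x∈Q = Bool.∧-zeroʳ (P x)

  abstract

    ⁅_⁆ : Fin n → Fin n → Bool
    ⁅ a ⁆ x = does (x ≟ a)

    ∈-⁅⁆ : ∀ a → a ∈ ⁅ a ⁆
    ∈-⁅⁆ a = dec-true (a ≟ a) refl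

    ∈-⁅⁆⁻ : ∀ {a x} → x ∈ ⁅ a ⁆ → x ≡ a
    ∈-⁅⁆⁻ {a} {x} = does-true (x ≟ a)

    ∉-⁅⁆ : ∀ {a x} → x ≢ a → x ∉ ⁅ a ⁆
    ∉-⁅⁆ {a} {x} = dec-false (x ≟ a)

  ∪⁅⁆-⊆ : ∀ {P Q : Fin n → Bool} {a} → P ⊆ Q → a ∈ Q → P ∪ ⁅ a ⁆ ⊆ Q
  ∪⁅⁆-⊆ {P} {Q} {a} P⊆Q a∈Q x h with ∈-∪⁻ P ⁅ a ⁆ h
  ... | inj₁ x∈P = P⊆Q x x∈P
  ... | inj₂ x∈a = subst (_∈ Q) (≡-sym (∈-⁅⁆⁻ x∈a)) a∈Q

count-mono : ∀ {n} {P Q : Fin n → Bool} → P ⊆ Q → count P ≤ count Q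
count-mono {zero}  P⊆Q = z≤n
count-mono {suc n} {P} {Q} P⊆Q = +-mono-≤ (head (P⊆Q zero)) (count-mono (P⊆Q ∘ suc))
  where
  head : ∀ {b c} → (b ≡ true → c ≡ true) → (if b then 1 else 0) ≤ (if c then 1 else 0)
  head {false}         _ = z≤n
  head {true}  {true}  _ = ≤-refl
  head {true}  {false} h with h refl
  ... | ()

count-cong : ∀ {n} {P Q : Fin n → Bool} → P ⊆ Q → Q ⊆ P → count P ≡ count Q
count-cong P⊆Q Q⊆P = ≤-antisym (count-mono P⊆Q) (count-mono Q⊆P)

count-insert : ∀ {n} {P Q : Fin n → Bool} a → a ∉ P → a ∈ Q →
  (∀ x → x ≢ a → P x ≡ Q x) → count Q ≡ suc (count P)
count-insert {suc n} {P} {Q} zero a∉P a∈Q P≗Q rewrite a∉P | a∈Q =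
  cong suc (≤-antisym
    (count-mono λ x x∈Q → trans (P≗Q (suc x) λ ()) x∈Q)
    (count-mono λ x x∈P → trans (≡-sym (P≗Q (suc x) λ ())) x∈P))
count-insert {suc n} {P} {Q} (suc a) a∉P a∈Q P≗Q
  rewrite P≗Q zero (λ ())
        | count-insert {P = P ∘ suc} {Q ∘ suc} a a∉P a∈Q (λ x x≢a → P≗Q (suc x) (x≢a ∘ suc-injective))
  = +-suc _ _

count-∪⁅⁆ : ∀ {n} (P : Fin n → Bool) {a} → a ∉ P → count (P ∪ ⁅ a ⁆) ≡ suc (count P)
count-∪⁅⁆ P {a} a∉P = count-insert a a∉P (∈-∪ʳ P ⁅ a ⁆ (∈-⁅⁆ a)) same
  where
  same : ∀ x → x ≢ a → P x ≡ P x ∨ ⁅ a ⁆ x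
  same x x≢a rewrite ∉-⁅⁆ x≢a = ≡-sym (Bool.∨-identityʳ (P x))

count-<-mono : ∀ {n} {P Q : Fin n → Bool} a → P ⊆ Q → a ∉ P → a ∈ Q → count P < count Q
count-<-mono {P = P} a P⊆Q a∉P a∈Q =
  ≤-trans (≤-reflexive (≡-sym (count-∪⁅⁆ P a∉P))) (count-mono (∪⁅⁆-⊆ P⊆Q a∈Q))

count-∅ : ∀ {n} {P : Fin n → Bool} → (∀ x → x ∉ P) → count P ≡ 0
count-∅ {zero}  _ = refl
count-∅ {suc n} ∉P rewrite ∉P zero = count-∅ (∉P ∘ suc)

count-⁅⁆ : ∀ {n} {P : Fin n → Bool} a → a ∈ P → (∀ x → x ∈ P → x ≡ a) → count P ≡ 1
count-⁅⁆ {n} {P} a a∈P unique =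
  trans (count-insert {P = ∅} a refl a∈P λ x x≢a → ≡-sym (Bool.¬-not (x≢a ∘ unique x)))
        (cong suc (count-∅ {n} {∅} λ _ → refl))

count-injection : ∀ {m n} {P : Fin n → Bool} (h : Fin m → Fin n) →
  Injective _≡_ _≡_ h → (∀ i → h i ∈ P) → m ≤ count P
count-injection {zero}  h _ _ = z≤n
count-injection {suc m} {P = P} h inj h∈P = ≤-trans
  (s≤s (count-injection (h ∘ suc) (suc-injective ∘ inj) λ i →
    ∈-∖ P ⁅ h zero ⁆ (h∈P (suc i)) (∉-⁅⁆ λ eq → contradiction (inj eq) λ ())))
  (count-<-mono (h zero) (λ x → proj₁ ∘ ∈-∖⁻ P ⁅ h zero ⁆)
    (∉-∖ʳ P ⁅ h zero ⁆ (∈-⁅⁆ (h zero))) (h∈P zero))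

count-enumerate : ∀ {n} k (P : Fin n → Bool) → k ≤ count P →
  ∃ λ (h : Fin k → Fin n) → Injective _≡_ _≡_ h × (∀ i → h i ∈ P)
count-enumerate zero P _ = (λ ()) , (λ {}) , λ ()
count-enumerate {suc n} (suc k) P k≤ with P zero in eq
... | false =
  let h , inj , h∈P = count-enumerate (suc k) (P ∘ suc) k≤
  in suc ∘ h , inj ∘ suc-injective , h∈P
... | true =
  let h , inj , h∈P = count-enumerate k (P ∘ suc) (s≤s⁻¹ k≤)
      h′ : Fin (suc k) → Fin (suc n)
      h′ = λ { zero → zero ; (suc i) → suc (h i) }
  in h′
   , (λ { {zero} {zero} _ → refl ; {suc i} {suc j} e → cong suc (inj (suc-injective e))
        ; {zero} {suc _} () ; {suc _} {zero} () })
   , λ { zero → eq ; (suc i) → h∈P i }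

count≥2 : ∀ {n} {P : Fin n → Bool} {a b} → a ≢ b → a ∈ P → b ∈ P → 2 ≤ count P
count≥2 {a = a} {b} a≢b a∈P b∈P = count-injection
  (λ { zero → a ; (suc zero) → b })
  (λ { {zero} {zero} _ → refl ; {suc zero} {suc zero} _ → refl
     ; {zero} {suc zero} e → ⊥-elim (a≢b e) ; {suc zero} {zero} e → ⊥-elim (a≢b (≡-sym e)) })
  λ { zero → a∈P ; (suc zero) → b∈P }

count≡1⇒unique : ∀ {n} {P : Fin n → Bool} {a b} → count P ≡ 1 → a ∈ P → b ∈ P → a ≡ b
count≡1⇒unique {a = a} {b} eq a∈P b∈P with a ≟ b
... | yes a≡b = a≡b
... | no  a≢b = contradiction (subst (2 ≤_) eq (count≥2 a≢b a∈P b∈P)) λ { (s≤s ()) }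

count≥1⇒∃ : ∀ {n} {P : Fin n → Bool} → 1 ≤ count P → ∃ (_∈ P)
count≥1⇒∃ {P = P} 1≤ = let h , _ , h∈P = count-enumerate 1 P 1≤ in h zero , h∈P zero

count≥2⇒other : ∀ {n} {P : Fin n → Bool} → 2 ≤ count P → ∀ a → ∃ λ b → b ≢ a × b ∈ P
count≥2⇒other {P = P} 2≤ a with count-enumerate 2 P 2≤
... | h , inj , h∈P with h zero ≟ a
...   | no  h₀≢a = h zero , h₀≢a , h∈P zero
...   | yes h₀≡a = h (suc zero) , (λ h₁≡a → contradiction (inj (trans h₀≡a (≡-sym h₁≡a))) λ ()) , h∈P (suc zero)

-- Both sides are the size of the union.
count-∖ : ∀ {n} (P Q : Fin n → Bool) → count P + count (Q ∖ P) ≡ count Q + count (P ∖ Q)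
count-∖ {zero}  P Q = refl
count-∖ {suc n} P Q with P zero | Q zero | count-∖ (P ∘ suc) (Q ∘ suc)
... | false | false | ih = ih
... | false | true  | ih = trans (+-suc _ _) (cong suc ih)
... | true  | false | ih = trans (cong suc ih) (≡-sym (+-suc _ _))
... | true  | true  | ih = cong suc ih

count-∖-⊆ : ∀ {n} {P Q : Fin n → Bool} → P ⊆ Q → count P + count (Q ∖ P) ≡ count Q
count-∖-⊆ {P = P} {Q} P⊆Q = trans (count-∖ P Q)
  (trans (cong (count Q +_) (count-∅ λ x → [ (λ x∈P → ∉-∖ʳ P Q (P⊆Q x x∈P)) , ∉-∖ˡ P Q ]′ (∈-or-∉ P x)))
         (+-identityʳ _))

count≤n : ∀ {n} (P : Fin n → Bool) → count P ≤ n
count≤n {n} P = ≤-trans (count-mono {n} {P} {const true} λ _ _ → refl) (≤-reflexive (count-true n))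
  where
  count-true : ∀ n → count {n} (const true) ≡ n
  count-true zero    = refl
  count-true (suc n) = cong suc (count-true n)

-- Terminates because each insertion shrinks the complement of the set. Barriers and connected
-- components are both built this way.
grow : ∀ {n} (Inv Done : (Fin n → Bool) → Set) →
  (∀ S → Inv S → Done S ⊎ ∃ λ x → x ∉ S × Inv (S ∪ ⁅ x ⁆)) →
  ∀ S → Inv S → ∃ λ T → Inv T × Done T
grow Inv Done next S inv = go S inv (<-wellFounded _)
  where
  go : ∀ S → Inv S → Acc _<_ (count (minus S)) → ∃ λ T → Inv T × Done T
  go S inv (acc rs) with next S inv
  ... | inj₁ done = S , inv , done
  ... | inj₂ (x , x∉S , inv′) = go (S ∪ ⁅ x ⁆) inv′ (rs (count-<-mono x shrink
          (cong not (∈-∪ʳ S ⁅ x ⁆ (∈-⁅⁆ x))) (cong not x∉S)))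
    where
    shrink : minus (S ∪ ⁅ x ⁆) ⊆ minus S
    shrink y h with S y
    ... | false = refl

sumFin-0 : ∀ {n} {f : Fin n → ℕ} → (∀ v → f v ≡ 0) → sumFin f ≡ 0
sumFin-0 {zero}  _ = refl
sumFin-0 {suc n} f≡0 = cong₂ _+_ (f≡0 zero) (sumFin-0 (f≡0 ∘ suc))

sumFin-0⁻ : ∀ {n} {f : Fin n → ℕ} → sumFin f ≡ 0 → ∀ v → f v ≡ 0
sumFin-0⁻ {f = f} eq zero    = m+n≡0⇒m≡0 (f zero) eq
sumFin-0⁻ {f = f} eq (suc v) = sumFin-0⁻ (m+n≡0⇒n≡0 (f zero) eq) v

sumFin-single : ∀ {n} {f : Fin n → ℕ} a → (∀ v → v ≢ a → f v ≡ 0) → sumFin f ≡ f a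
sumFin-single {f = f} zero f≡0 =
  trans (cong (f zero +_) (sumFin-0 λ v → f≡0 (suc v) λ ())) (+-identityʳ _)
sumFin-single (suc a) f≡0 =
  cong₂ _+_ (f≡0 zero λ ()) (sumFin-single a λ v v≢a → f≡0 (suc v) (v≢a ∘ suc-injective))

-- Packings and the exchange property

-- A vector rather than a function, so that an assignment with a decidable property can be found by
-- exhaustive search; this supplies the case distinctions that would otherwise need excluded middle.
Assignment : ℕ → Set
Assignment n = Vec (Maybe (Fin n)) n

∃Vec? : ∀ {A : Set} {m} →
  (∀ {P : A → Set} → (∀ x → Dec (P x)) → Dec (∃ P)) →
  ∀ {P : Vec A m → Set} → (∀ v → Dec (P v)) → Dec (∃ P)
∃Vec? {m = zero}  ∃A? P? = map′ ([] ,_) (λ { ([] , p) → p }) (P? [])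
∃Vec? {m = suc m} ∃A? P? = map′
  (λ { (x , v , p) → x ∷ v , p }) (λ { (x ∷ v , p) → x , v , p })
  (∃A? λ x → ∃Vec? ∃A? λ v → P? (x ∷ v))

∃Maybe? : ∀ {n} {P : Maybe (Fin n) → Set} → (∀ x → Dec (P x)) → Dec (∃ P)
∃Maybe? P? = map′
  [ (nothing ,_) , (λ { (x , p) → just x , p }) ]′
  (λ { (nothing , p) → inj₁ p ; (just x , p) → inj₂ (x , p) })
  (P? nothing ⊎-dec any? (P? ∘ just))

∃Assignment? : ∀ {n} {P : Assignment n → Set} → (∀ f → Dec (P f)) → Dec (∃ P)
∃Assignment? = ∃Vec? ∃Maybe?

_≟ᴹ_ : ∀ {n} (p q : Maybe (Fin n)) → Dec (p ≡ q)
_≟ᴹ_ = Maybe.≡-dec _≟_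

module _ {n : ℕ} where

  cov : Assignment n → Fin n → Bool
  cov f x = is-just (lookup f x)

  size : Assignment n → ℕ
  size f = count (cov f)

  module _ {f : Assignment n} {x : Fin n} where

    just⇒∈cov : ∀ {y} → lookup f x ≡ just y → x ∈ cov f
    just⇒∈cov = cong is-just

    ∈cov⇒just : x ∈ cov f → ∃ λ y → lookup f x ≡ just y
    ∈cov⇒just h with lookup f x
    ... | just y = y , refl

  pair : Fin n → Fin n → Fin n → Bool
  pair a b = ⁅ a ⁆ ∪ ⁅ b ⁆

  module _ {a b : Fin n} where

    pairˡ : a ∈ pair a b
    pairˡ = ∈-∪ˡ ⁅ a ⁆ ⁅ b ⁆ (∈-⁅⁆ a)

    pairʳ : b ∈ pair a b
    pairʳ = ∈-∪ʳ ⁅ a ⁆ ⁅ b ⁆ (∈-⁅⁆ b)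

    pair⁻ : ∀ {x} → x ∈ pair a b → x ≡ a ⊎ x ≡ b
    pair⁻ h with ∈-∪⁻ ⁅ a ⁆ ⁅ b ⁆ h
    ... | inj₁ x∈a = inj₁ (∈-⁅⁆⁻ x∈a)
    ... | inj₂ x∈b = inj₂ (∈-⁅⁆⁻ x∈b)

    ∉-pair : ∀ {x} → x ≢ a → x ≢ b → x ∉ pair a b
    ∉-pair x≢a x≢b = ∉-∪ ⁅ a ⁆ ⁅ b ⁆ (∉-⁅⁆ x≢a) (∉-⁅⁆ x≢b)

  abstract

    override : (Fin n → Bool) → (Fin n → Maybe (Fin n)) → Assignment n → Assignment n
    override P g f = tabulate λ x → if P x then g x else lookup f x

    override-∈ : ∀ {P g f x} → x ∈ P → lookup (override P g f) x ≡ g x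
    override-∈ {g = g} {f} {x} x∈P = trans (lookup∘tabulate _ x)
      (cong (λ b → if b then g x else lookup f x) x∈P)

    override-∉ : ∀ {P g f x} → x ∉ P → lookup (override P g f) x ≡ lookup f x
    override-∉ {g = g} {f} {x} x∉P = trans (lookup∘tabulate _ x)
      (cong (λ b → if b then g x else lookup f x) x∉P)

  assign : (Fin n → Bool) → Fin n → Assignment n → Assignment n
  assign P y = override P (const (just y))

  release : (Fin n → Bool) → Assignment n → Assignment n
  release P = override P (const nothing)

  module _ {P : Fin n → Bool} {f : Assignment n} {x : Fin n} where

    assign-∈ : ∀ {y} → x ∈ P → lookup (assign P y f) x ≡ just y
    assign-∈ {y} = override-∈ {g = const (just y)}

    assign-∉ : ∀ {y} → x ∉ P → lookup (assign P y f) x ≡ lookup f x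
    assign-∉ {y} = override-∉ {g = const (just y)}

    release-∈ : x ∈ P → lookup (release P f) x ≡ nothing
    release-∈ = override-∈ {g = const nothing} {f}

    release-∉ : x ∉ P → lookup (release P f) x ≡ lookup f x
    release-∉ = override-∉ {g = const nothing}

-- A packing gives each element of X at most one value, a neighbour in G, so that
-- no value is taken exactly once: the subgraphs with degrees {0,1} on X and L(y) on Y.
record Packing {n} (G : Graph n) (X : Fin n → Bool) (f : Assignment n) : Set where
  field
    legal : ∀ {x y} → lookup f x ≡ just y → x ∈ X × adj G x y ≡ true
    mate  : ∀ {x y} → lookup f x ≡ just y → ∃ λ x′ → x′ ≢ x × lookup f x′ ≡ just y
open Packing

packing-mono : ∀ {n} {G : Graph n} {X X′ f} → X ⊆ X′ → Packing G X f → Packing G X′ f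
packing-mono X⊆X′ p .legal eq = let x∈X , e = legal p eq in X⊆X′ _ x∈X , e
packing-mono X⊆X′ p .mate = mate p

module _ {n : ℕ} (G : Graph n) (X : Fin n → Bool) where

  empty-packing : Packing G X (replicate n nothing)
  empty-packing .legal {x} eq =
    contradiction (trans (≡-sym (lookup-replicate x nothing)) eq) λ ()
  empty-packing .mate {x} eq =
    contradiction (trans (≡-sym (lookup-replicate x nothing)) eq) λ ()

  packing? : ∀ f → Dec (Packing G X f)
  packing? f = map′
    (λ h → record { legal = λ {x} {y} eq → proj₁ (h x y eq) , proj₁ (proj₂ (h x y eq))
                  ; mate  = λ {x} {y} eq → proj₂ (proj₂ (h x y eq)) })
    (λ p x y eq → proj₁ (legal p eq) , proj₂ (legal p eq) , mate p eq)
    (all? λ x → all? λ y → (lookup f x ≟ᴹ just y) →-dec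
      ((x ∈? X) ×-dec (adj G x y Bool.≟ true) ×-dec
        any? λ x′ → ¬? (x′ ≟ x) ×-dec (lookup f x′ ≟ᴹ just y)))

module _ {n : ℕ} {G : Graph n} {X : Fin n → Bool} where

  -- Only uncovered elements receive a value, so all old mates survive and only the elements of P
  -- need a partner.
  assign-packing : ∀ {f y} P → Packing G X f →
    (∀ {x} → x ∈ P → x ∉ cov f × x ∈ X × adj G x y ≡ true) →
    (∀ {x} → x ∈ P → ∃ λ x′ → x′ ≢ x × (x′ ∈ P ⊎ lookup f x′ ≡ just y)) →
    Packing G X (assign P y f)
  assign-packing {f} {y} P pf new partner = record { legal = legal′ ; mate = mate′ }
    where
    f′ = assign P y f
    old : ∀ {x v} → lookup f x ≡ just v → lookup f′ x ≡ just v
    old {x} eq with ∈-or-∉ P x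
    ... | inj₁ x∈P = ⊥-elim (∈∉⇒⊥ (just⇒∈cov {f = f} eq) (proj₁ (new x∈P)))
    ... | inj₂ x∉P = trans (assign-∉ x∉P) eq
    legal′ : ∀ {x v} → lookup f′ x ≡ just v → x ∈ X × adj G x v ≡ true
    legal′ {x} eq with ∈-or-∉ P x
    ... | inj₂ x∉P = legal pf (trans (≡-sym (assign-∉ x∉P)) eq)
    ... | inj₁ x∈P with refl ← trans (≡-sym (assign-∈ x∈P)) eq = proj₂ (new x∈P)
    mate′ : ∀ {x v} → lookup f′ x ≡ just v → ∃ λ x′ → x′ ≢ x × lookup f′ x′ ≡ just v
    mate′ {x} eq with ∈-or-∉ P x
    ... | inj₂ x∉P = let x′ , x′≢x , eq′ = mate pf (trans (≡-sym (assign-∉ x∉P)) eq)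
                     in x′ , x′≢x , old eq′
    ... | inj₁ x∈P with refl ← trans (≡-sym (assign-∈ x∈P)) eq | partner x∈P
    ...   | x′ , x′≢x , inj₁ x′∈P = x′ , x′≢x , assign-∈ x′∈P
    ...   | x′ , x′≢x , inj₂ eq′  = x′ , x′≢x , old eq′

  release-packing : ∀ {f} P → Packing G X f →
    (∀ {x v} → x ∉ P → lookup f x ≡ just v → ∃ λ x′ → x′ ≢ x × x′ ∉ P × lookup f x′ ≡ just v) →
    Packing G X (release P f)
  release-packing {f} P pf partner = record
    { legal = λ eq → legal pf (proj₂ (kept eq))
    ; mate  = λ eq → let x′ , x′≢x , x′∉P , eq′ = partner (proj₁ (kept eq)) (proj₂ (kept eq))
                     in x′ , x′≢x , trans (release-∉ x′∉P) eq′ }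
    where
    kept : ∀ {x v} → lookup (release P f) x ≡ just v → x ∉ P × lookup f x ≡ just v
    kept {x} eq with ∈-or-∉ P x
    ... | inj₂ x∉P = x∉P , trans (≡-sym (release-∉ x∉P)) eq
    ... | inj₁ x∈P = contradiction (trans (≡-sym (release-∈ x∈P)) eq) λ ()

  assign-one : ∀ {f a b y} → Packing G X f → a ∉ cov f → a ∈ X → adj G a y ≡ true →
    lookup f b ≡ just y → Packing G X (assign ⁅ a ⁆ y f)
  assign-one {f} {a} {b} {y} pf a∉f a∈X e fb = assign-packing ⁅ a ⁆ pf new partner
    where
    new : ∀ {x} → x ∈ ⁅ a ⁆ → x ∉ cov f × x ∈ X × adj G x y ≡ true
    new x∈ with refl ← ∈-⁅⁆⁻ {a = a} x∈ = a∉f , a∈X , e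
    partner : ∀ {x} → x ∈ ⁅ a ⁆ → ∃ λ x′ → x′ ≢ x × (x′ ∈ ⁅ a ⁆ ⊎ lookup f x′ ≡ just y)
    partner x∈ with refl ← ∈-⁅⁆⁻ {a = a} x∈ =
      b , (λ { refl → ∈∉⇒⊥ (just⇒∈cov {f = f} fb) a∉f }) , inj₂ fb

  assign-pair : ∀ {f a b y} → Packing G X f → a ≢ b → a ∉ cov f → b ∉ cov f →
    a ∈ X × adj G a y ≡ true → b ∈ X × adj G b y ≡ true → Packing G X (assign (pair a b) y f)
  assign-pair {f} {a} {b} {y} pf a≢b a∉f b∉f ea eb = assign-packing (pair a b) pf new partner
    where
    new : ∀ {x} → x ∈ pair a b → x ∉ cov f × x ∈ X × adj G x y ≡ true
    new x∈ with pair⁻ x∈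
    ... | inj₁ refl = a∉f , ea
    ... | inj₂ refl = b∉f , eb
    partner : ∀ {x} → x ∈ pair a b → ∃ λ x′ → x′ ≢ x × (x′ ∈ pair a b ⊎ lookup f x′ ≡ just y)
    partner x∈ with pair⁻ x∈
    ... | inj₁ refl = b , ≢-sym a≢b , inj₁ pairʳ
    ... | inj₂ refl = a , a≢b , inj₁ pairˡ

  -- A class of at least three elements can lose one: an element whose mate was b still has c or d.
  release-one : ∀ {f b c d z} → Packing G X f → c ≢ b → d ≢ b → c ≢ d →
    lookup f b ≡ just z → lookup f c ≡ just z → lookup f d ≡ just z →
    Packing G X (release ⁅ b ⁆ f)
  release-one {f} {b} {c} {d} {z} pf c≢b d≢b c≢d fb fc fd = release-packing ⁅ b ⁆ pf partner
    where
    partner : ∀ {x v} → x ∉ ⁅ b ⁆ → lookup f x ≡ just v →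
      ∃ λ x′ → x′ ≢ x × x′ ∉ ⁅ b ⁆ × lookup f x′ ≡ just v
    partner {x} _ eq with mate pf eq
    ... | x′ , x′≢x , eq′ with x′ ≟ b
    ...   | no x′≢b = x′ , x′≢x , ∉-⁅⁆ x′≢b , eq′
    ...   | yes refl with refl ← trans (≡-sym fb) eq′ | c ≟ x
    ...     | no c≢x   = c , c≢x , ∉-⁅⁆ c≢b , fc
    ...     | yes refl = d , ≢-sym c≢d , ∉-⁅⁆ d≢b , fd

  -- The class of z is exactly the pair, so no remaining element relies on b or c for its mate.
  release-pair : ∀ {f b c z} → Packing G X f → lookup f b ≡ just z → lookup f c ≡ just z →
    (∀ {d} → lookup f d ≡ just z → d ∈ pair b c) → Packing G X (release (pair b c) f)
  release-pair {f} {b} {c} {z} pf fb fc only = release-packing (pair b c) pf partner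
    where
    value : ∀ {x} → x ∈ pair b c → lookup f x ≡ just z
    value x∈ with pair⁻ x∈
    ... | inj₁ refl = fb
    ... | inj₂ refl = fc
    partner : ∀ {x v} → x ∉ pair b c → lookup f x ≡ just v →
      ∃ λ x′ → x′ ≢ x × x′ ∉ pair b c × lookup f x′ ≡ just v
    partner {x} x∉ eq with mate pf eq
    ... | x′ , x′≢x , eq′ with ∈-or-∉ (pair b c) x′
    ...   | inj₂ x′∉ = x′ , x′≢x , x′∉ , eq′
    ...   | inj₁ x′∈ =
      ⊥-elim (∈∉⇒⊥ (only (trans eq (trans (≡-sym eq′) (value x′∈)))) x∉)

module _ {n : ℕ} {P : Fin n → Bool} {f : Assignment n} {x : Fin n} where

  cov-assign-∈ : ∀ {y} → x ∈ P → x ∈ cov (assign P y f)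
  cov-assign-∈ x∈P = cong is-just (assign-∈ x∈P)

  cov-assign-∉ : ∀ {y} → x ∉ P → cov (assign P y f) x ≡ cov f x
  cov-assign-∉ x∉P = cong is-just (assign-∉ x∉P)

  cov-release-∈ : x ∈ P → x ∉ cov (release P f)
  cov-release-∈ x∈P = cong is-just (release-∈ x∈P)

  cov-release-∉ : x ∉ P → cov (release P f) x ≡ cov f x
  cov-release-∉ x∉P = cong is-just (release-∉ x∉P)

cov-assign-⊇ : ∀ {n} {P : Fin n → Bool} {f y} → cov f ⊆ cov (assign P y f)
cov-assign-⊇ {P = P} x x∈f with ∈-or-∉ P x
... | inj₁ x∈P = cov-assign-∈ x∈P
... | inj₂ x∉P = trans (cov-assign-∉ x∉P) x∈f

-- The basis exchange step Q = P - c + a.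
record Swap {n} (P Q : Fin n → Bool) (a c : Fin n) : Set where
  field
    old-in   : c ∈ P
    old-out  : c ∉ Q
    new-out  : a ∉ P
    new-in   : a ∈ Q
    same     : ∀ x → x ≢ a → x ≢ c → P x ≡ Q x
open Swap

swap-count : ∀ {n} {P Q : Fin n → Bool} {a c} → Swap P Q a c → count P ≡ count Q
swap-count {P = P} {Q} {a} {c} s = cong pred
  (trans (≡-sym (count-∪⁅⁆ P (new-out s))) (count-insert c (old-out s) (∈-∪ˡ P ⁅ a ⁆ (old-in s)) agree))
  where
  agree : ∀ x → x ≢ c → Q x ≡ (P ∪ ⁅ a ⁆) x
  agree x x≢c with x ≟ a
  ... | yes refl = trans (new-in s) (≡-sym (∈-∪ʳ P ⁅ a ⁆ (∈-⁅⁆ a)))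
  ... | no  x≢a  = trans (≡-sym (same s x x≢a x≢c))
                     (trans (≡-sym (Bool.∨-identityʳ (P x))) (cong (P x ∨_) (≡-sym (∉-⁅⁆ x≢a))))

module _ {n : ℕ} {G : Graph n} {X : Fin n → Bool} where

  -- The matroid exchange alternative: a is gained at no loss, or at the price of one element that g
  -- does not cover. The gain is only an inclusion, since a may bring an uncovered mate along.
  Exchanged : Assignment n → Assignment n → Fin n → Set
  Exchanged f g a = ∃ λ f′ → Packing G X f′ ×
    ((a ∈ cov f′ × cov f ⊆ cov f′) ⊎ ∃ λ c → c ∉ cov g × Swap (cov f) (cov f′) a c)

  -- The number of these elements is the termination measure of `exchange`.
  wrong? : ∀ (f g : Assignment n) x → Dec (x ∈ cov f × lookup f x ≢ lookup g x)
  wrong? f g x = (x ∈? cov f) ×-dec ¬? (lookup f x ≟ᴹ lookup g x)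

  -- Move a to its value under g; if it would be alone there, bring along another element b of
  -- its g-class; if b leaves behind a single element c, uncover c and continue from c.
  exchange : ∀ {f g a} → Packing G X f → Packing G X g → a ∉ cov f → a ∈ cov g → Exchanged f g a
  exchange {f} {g} pf pg = go f pf (<-wellFounded _)
    where
    go : ∀ f → Packing G X f → Acc _<_ (count (does ∘ wrong? f g)) →
      ∀ {a} → a ∉ cov f → a ∈ cov g → Exchanged f g a
    go f pf (acc rs) {a} a∉f a∈g with ∈cov⇒just {f = g} a∈g
    ... | y , ga with any? (λ x → lookup f x ≟ᴹ just y)
    ...   | yes (x , fx) = assign ⁅ a ⁆ y f
          , assign-one pf a∉f (proj₁ (legal pg ga)) (proj₂ (legal pg ga)) fx
          , inj₁ (cov-assign-∈ (∈-⁅⁆ a) , cov-assign-⊇)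
    ...   | no noy with mate pg ga
    ...     | b , b≢a , gb with ∈-or-∉ (cov f) b
    ...       | inj₂ b∉f = assign (pair a b) y f
              , assign-pair pf (≢-sym b≢a) a∉f b∉f (legal pg ga) (legal pg gb)
              , inj₁ (cov-assign-∈ (pairˡ {a = a} {b}) , cov-assign-⊇)
    ...       | inj₁ b∈f with ∈cov⇒just {f = f} b∈f
    ...         | z , fb with mate pf fb
    ...           | c , c≢b , fc with any? (λ d → ¬? (d ≟ b) ×-dec ¬? (d ≟ c) ×-dec (lookup f d ≟ᴹ just z))
    ...             | yes (d , d≢b , d≢c , fd) = assign (pair a b) y (release ⁅ b ⁆ f)
                    , assign-pair (release-one pf c≢b d≢b (≢-sym d≢c) fb fc fd) (≢-sym b≢a)
                        (trans (cov-release-∉ (∉-⁅⁆ (≢-sym b≢a))) a∉f) (cov-release-∈ (∈-⁅⁆ b))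
                        (legal pg ga) (legal pg gb)
                    , inj₁ (cov-assign-∈ (pairˡ {a = a} {b}) , covers)
      where
      covers : cov f ⊆ cov (assign (pair a b) y (release ⁅ b ⁆ f))
      covers x x∈f with x ≟ b
      ... | yes refl = cov-assign-∈ (pairʳ {a = a} {b})
      ... | no  x≢b  = cov-assign-⊇ x (trans (cov-release-∉ (∉-⁅⁆ x≢b)) x∈f)
    ...             | no only = continue (∈-or-∉ (cov g) c)
      where
      f₀ = release (pair b c) f
      f₁ = assign (pair a b) y f₀
      c≢a : c ≢ a
      c≢a refl = ∈∉⇒⊥ (just⇒∈cov {f = f} fc) a∉f
      only-bc : ∀ {d} → lookup f d ≡ just z → d ∈ pair b c
      only-bc {d} fd with d ≟ b | d ≟ c
      ... | yes refl | _        = pairˡ {a = b} {c}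
      ... | no _     | yes refl = pairʳ {a = b} {c}
      ... | no d≢b   | no d≢c   = contradiction (d , d≢b , d≢c , fd) only
      p₁ : Packing G X f₁
      p₁ = assign-pair (release-pair pf fb fc only-bc) (≢-sym b≢a)
             (trans (cov-release-∉ (∉-pair (≢-sym b≢a) (≢-sym c≢a))) a∉f)
             (cov-release-∈ (pairˡ {a = b} {c})) (legal pg ga) (legal pg gb)
      f₁a : lookup f₁ a ≡ just y
      f₁a = assign-∈ (pairˡ {a = a} {b})
      f₁b : lookup f₁ b ≡ just y
      f₁b = assign-∈ (pairʳ {a = a} {b})
      c∉f₁ : c ∉ cov f₁
      c∉f₁ = trans (cov-assign-∉ (∉-pair c≢a c≢b)) (cov-release-∈ (pairʳ {a = b} {c}))
      f₁-other : ∀ {x} → x ≢ a → x ≢ b → x ≢ c → lookup f₁ x ≡ lookup f x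
      f₁-other x≢a x≢b x≢c = trans (assign-∉ (∉-pair x≢a x≢b)) (release-∉ (∉-pair x≢b x≢c))
      swap₁ : Swap (cov f) (cov f₁) a c
      swap₁ = record
        { old-in = just⇒∈cov {f = f} fc ; old-out = c∉f₁
        ; new-out = a∉f ; new-in = just⇒∈cov {f = f₁} f₁a ; same = same₁ }
        where
        same₁ : ∀ x → x ≢ a → x ≢ c → cov f x ≡ cov f₁ x
        same₁ x x≢a x≢c with x ≟ b
        ... | yes refl = trans b∈f (≡-sym (just⇒∈cov {f = f₁} f₁b))
        ... | no  x≢b  = cong is-just (≡-sym (f₁-other x≢a x≢b x≢c))
      -- Since f never takes the value y, b was wrong; now it has its value under g. So has the
      -- newly covered a, and c is uncovered, so no element becomes wrong.
      fewer-wrong : count (does ∘ wrong? f₁ g) < count (does ∘ wrong? f g)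
      fewer-wrong = count-<-mono b shrink
        (dec-false (wrong? f₁ g b) λ (_ , ≢g) → ≢g (trans f₁b (≡-sym gb)))
        (dec-true (wrong? f g b) (b∈f , λ eq → noy (b , trans eq gb)))
        where
        shrink : (does ∘ wrong? f₁ g) ⊆ (does ∘ wrong? f g)
        shrink x h with does-true (wrong? f₁ g x) h
        ... | x∈f₁ , ≢g = dec-true (wrong? f g x)
              (trans (cong is-just (≡-sym f₁x)) x∈f₁ , λ eq → ≢g (trans f₁x eq))
          where
          f₁x : lookup f₁ x ≡ lookup f x
          f₁x = f₁-other (λ { refl → ≢g (trans f₁a (≡-sym ga)) }) (λ { refl → ≢g (trans f₁b (≡-sym gb)) })
                         (λ { refl → ∈∉⇒⊥ x∈f₁ c∉f₁ })
      continue : c ∈ cov g ⊎ c ∉ cov g → Exchanged f g a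
      continue (inj₂ c∉g) = f₁ , p₁ , inj₂ (c , c∉g , swap₁)
      continue (inj₁ c∈g) with go f₁ p₁ (rs fewer-wrong) c∉f₁ c∈g
      ... | f′ , p′ , inj₁ (c∈f′ , f₁⊆f′) = f′ , p′ , inj₁ (f₁⊆f′ a (new-in swap₁) , covers)
        where
        covers : cov f ⊆ cov f′
        covers x x∈f with x ≟ c
        ... | yes refl = c∈f′
        ... | no  x≢c  = f₁⊆f′ x (trans (≡-sym (same swap₁ x (λ { refl → ∈∉⇒⊥ x∈f a∉f }) x≢c)) x∈f)
      -- Exchanging c for a and then d for c restores c, so the composite exchanges d for a.
      ... | f′ , p′ , inj₂ (d , d∉g , swap₂) = f′ , p′ , inj₂ (d , d∉g , record
              { old-in = trans (same swap₁ d d≢a d≢c) (old-in swap₂) ; old-out = old-out swap₂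
              ; new-out = a∉f
              ; new-in = trans (≡-sym (same swap₂ a (≢-sym c≢a) (≢-sym d≢a))) (new-in swap₁)
              ; same = same′ })
        where
        d≢a : d ≢ a
        d≢a refl = ∈∉⇒⊥ a∈g d∉g
        d≢c : d ≢ c
        d≢c refl = ∈∉⇒⊥ c∈g d∉g
        same′ : ∀ x → x ≢ a → x ≢ d → cov f x ≡ cov f′ x
        same′ x x≢a x≢d with x ≟ c
        ... | yes refl = trans (old-in swap₁) (≡-sym (new-in swap₂))
        ... | no  x≢c  = trans (same swap₁ x x≢a x≢c) (same swap₂ x x≢c x≢d)

-- Maximum packings and exposed vertices

module _ {n : ℕ} {G : Graph n} {X : Fin n → Bool} where

  -- The three ways in which the walk of `uncover` can stop. The first two are gains, which size
  -- bounds rule out wherever the lemma is applied; the third keeps the size k and misses v together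
  -- with a point of P.
  Uncovered : (Fin n → Bool) → Fin n → ℕ → Set
  Uncovered P v k = ∃ λ N′ → Packing G X N′ ×
    ((v ∉ cov N′ × k < size N′) ⊎
     (2 + k ≤ size N′) ⊎
     (v ∉ cov N′ × size N′ ≡ k × ∃ λ p → p ∈ P × p ∉ cov N′))

  -- Basis exchange, moving N towards M inside the matroid of coverable sets.
  uncover : ∀ {N M v} (P : Fin n → Bool) → Packing G X N → Packing G X M → v ∉ cov N →
    (∀ x → x ∈ P → x ∉ cov M) → 2 + size N ≤ size M + count P →
    Uncovered P v (size N)
  uncover {N} {M} {v} P pN pM v∉N P∩M=∅ large = go N pN v∉N large (<-wellFounded _)
    where
    go : ∀ N → Packing G X N → v ∉ cov N → 2 + size N ≤ size M + count P →
      Acc _<_ (count (cov M ∖ cov N)) →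
      Uncovered P v (size N)
    go N pN v∉N large (acc rs) with any? (λ p → (p ∈? P) ×-dec (cov N p Bool.≟ false))
    ... | yes found = N , pN , inj₂ (inj₂ (v∉N , refl , found))
    -- As N covers all of P, the size hypothesis forces two elements of M outside N, so one of them
    -- differs from v and can be brought in instead of v.
    ... | no none with count≥2⇒other two v
      where
      P⊆N∖M : P ⊆ cov N ∖ cov M
      P⊆N∖M p p∈P with ∈-or-∉ (cov N) p
      ... | inj₁ p∈N = ∈-∖ (cov N) (cov M) p∈N (P∩M=∅ p p∈P)
      ... | inj₂ p∉N = contradiction (p , p∈P , p∉N) none
      two : 2 ≤ count (cov M ∖ cov N)
      two = +-cancelʳ-≤ (size N) 2 _ (begin
        2 + size N                        ≤⟨ large ⟩
        size M + count P                  ≤⟨ +-monoʳ-≤ (size M) (count-mono P⊆N∖M) ⟩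
        size M + count (cov N ∖ cov M)    ≡⟨ count-∖ (cov M) (cov N) ⟩
        size N + count (cov M ∖ cov N)    ≡⟨ +-comm (size N) _ ⟩
        count (cov M ∖ cov N) + size N    ∎)
        where open ≤-Reasoning
    ...   | a , a≢v , a∈M∖N with ∈-∖⁻ (cov M) (cov N) a∈M∖N
    ...     | a∈M , a∉N with exchange pN pM a∉N a∈M
    ...       | N′ , pN′ , inj₁ (a∈N′ , N⊆N′) = N′ , pN′ , gain (∈-or-∉ (cov N′) v)
      where
      N+a⊆N′ : cov N ∪ ⁅ a ⁆ ⊆ cov N′
      N+a⊆N′ = ∪⁅⁆-⊆ N⊆N′ a∈N′
      -- If v gets covered along with a, the packing has grown by at least two.
      gain : v ∈ cov N′ ⊎ v ∉ cov N′ → _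
      gain (inj₂ v∉N′) = inj₁ (v∉N′ , count-<-mono a N⊆N′ a∉N a∈N′)
      gain (inj₁ v∈N′) = inj₂ (inj₁ (≤-trans (s≤s (≤-reflexive (≡-sym (count-∪⁅⁆ (cov N) a∉N))))
        (count-<-mono v N+a⊆N′ (∉-∪ (cov N) ⁅ a ⁆ v∉N (∉-⁅⁆ (≢-sym a≢v))) v∈N′)))
    ...       | N′ , pN′ , inj₂ (c , c∉M , swap) = subst (Uncovered P v) (≡-sym N≡N′)
        (go N′ pN′ v∉N′ (subst (λ k → 2 + k ≤ size M + count P) N≡N′ large)
          (rs (count-<-mono a closer (∉-∖ʳ (cov M) (cov N′) (new-in swap)) a∈M∖N)))
      where
      N≡N′ : size N ≡ size N′
      N≡N′ = swap-count swap
      v≢c : v ≢ c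
      v≢c refl = ∈∉⇒⊥ (old-in swap) v∉N
      v∉N′ : v ∉ cov N′
      v∉N′ = trans (≡-sym (same swap v (≢-sym a≢v) v≢c)) v∉N
      -- The element c that leaves N lies outside M, so this difference gains nothing, while it
      -- loses a.
      closer : cov M ∖ cov N′ ⊆ cov M ∖ cov N
      closer x h with ∈-∖⁻ (cov M) (cov N′) h
      ... | x∈M , x∉N′ = ∈-∖ (cov M) (cov N) x∈M
        (trans (same swap x (λ { refl → ∈∉⇒⊥ (new-in swap) x∉N′ }) (λ { refl → ∈∉⇒⊥ x∈M c∉M })) x∉N′)

module _ {n : ℕ} (G : Graph n) (X : Fin n → Bool) where

  Maximum : Assignment n → Set
  Maximum M = Packing G X M × (∀ N → Packing G X N → size N ≤ size M)

  ∃maximum : ∃ Maximum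
  ∃maximum = go n (replicate n nothing) (empty-packing G X) (m≤n+m n _)
    where
    -- The bound keeps `fuel` at least the number of elements that M leaves uncovered, so with no
    -- fuel left no packing can be larger.
    go : ∀ fuel M → Packing G X M → n ≤ size M + fuel → ∃ Maximum
    go fuel M pM bound with ∃Assignment? (λ N → packing? G X N ×-dec (size M <? size N))
    ... | no none = M , pM , λ N pN → ≮⇒≥ λ M<N → none (N , pN , M<N)
    go zero M pM bound | yes (N , pN , M<N) =
      contradiction (≤-trans M<N (≤-trans (count≤n (cov N)) (subst (n ≤_) (+-identityʳ _) bound))) (<-irrefl refl)
    go (suc fuel) M pM bound | yes (N , pN , M<N) =
      go fuel N pN (≤-trans bound (≤-trans (≤-reflexive (+-suc _ fuel)) (+-monoˡ-≤ fuel M<N)))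

  -- the set D of the Gallai–Edmonds decomposition
  Exposed : Fin n → Set
  Exposed x = ∃ λ M → Maximum M × x ∉ cov M

  -- Maximality quantifies over all packings, but comparing sizes with one fixed maximum packing
  -- decides it.
  exposed? : ∀ x → Dec (Exposed x)
  exposed? x with ∃maximum
  ... | M , pM , max = map′
    (λ { (N , pN , M≤N , x∉N) → N , (pN , λ K pK → ≤-trans (max K pK) M≤N) , x∉N })
    (λ { (N , (pN , maxN) , x∉N) → N , pN , maxN M pM , x∉N })
    (∃Assignment? λ N → packing? G X N ×-dec (size M ≤? size N) ×-dec (cov N x Bool.≟ false))

  -- For distinct exposed u and v this says that they form a cocircuit, that is, are in series in
  -- the matroid. Allowing u = v makes the relation reflexive, which starts the induction in
  -- `spread-from`.
  Series : Fin n → Fin n → Set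
  Series u v = ∀ {M} → Maximum M → u ∉ cov M → v ∉ cov M → u ≡ v

module _ {n : ℕ} {G : Graph n} {X : Fin n → Bool} where

  -- Sent to the common neighbour y, a and b are mates of each other, whether or not N already uses
  -- y.
  cover-pair : ∀ {N a b y} → Packing G X N → a ≢ b → a ∉ cov N → b ∉ cov N →
    a ∈ X × adj G a y ≡ true → b ∈ X × adj G b y ≡ true →
    ∃ λ N′ → Packing G X N′ × 2 + size N ≤ size N′
  cover-pair {N} {a} {b} {y} pN a≢b a∉N b∉N ea eb =
      assign (pair a b) y N , assign-pair pN a≢b a∉N b∉N ea eb
    , ≤-trans (s≤s (≤-reflexive (≡-sym (count-∪⁅⁆ (cov N) a∉N))))
        (count-<-mono b (∪⁅⁆-⊆ cov-assign-⊇ (cov-assign-∈ (pairˡ {a = a} {b})))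
          (∉-∪ (cov N) ⁅ a ⁆ b∉N (∉-⁅⁆ (≢-sym a≢b))) (cov-assign-∈ (pairʳ {a = a} {b})))

  adjacent-series : ∀ {a b y} → a ∈ X × adj G a y ≡ true → b ∈ X × adj G b y ≡ true → Series G X a b
  adjacent-series {a} {b} ea eb (pM , max) a∉M b∉M with a ≟ b
  ... | yes a≡b = a≡b
  ... | no  a≢b = let N , pN , bigger = cover-pair pM a≢b a∉M b∉M ea eb
                  in contradiction (≤-trans bigger (max N pN)) (<⇒≱ (n<1+n _) ∘ <⇒≤)

  -- Suppose a maximum M missed distinct u and w. Walking towards M from a maximum packing that
  -- misses a, `uncover` reaches a maximum packing missing a and one of u, w. By hypothesis that
  -- vertex equals a, and the other hypothesis, applied to M, gives u = w.
  series-trans : ∀ {u a w} → Exposed G X a → Series G X u a → Series G X a w → Series G X u w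
  series-trans {u} {a} {w} (N , maxN , a∉N) u~a a~w {M} maxM u∉M w∉M with u ≟ w
  ... | yes u≡w = u≡w
  ... | no  u≢w with uncover (pair u w) (proj₁ maxN) (proj₁ maxM) a∉N missed
          (≤-trans (≤-reflexive (+-comm 2 _)) (+-mono-≤ (proj₂ maxM N (proj₁ maxN))
            (count≥2 u≢w (pairˡ {a = u} {w}) (pairʳ {a = u} {w}))))
    where
    missed : ∀ x → x ∈ pair u w → x ∉ cov M
    missed x x∈ with pair⁻ {a = u} {w} x∈
    ... | inj₁ refl = u∉M
    ... | inj₂ refl = w∉M
  ...   | N′ , pN′ , inj₁ (_ , bigger) = contradiction (proj₂ maxN N′ pN′) (<⇒≱ bigger)
  ...   | N′ , pN′ , inj₂ (inj₁ bigger) = contradiction (proj₂ maxN N′ pN′) (<⇒≱ (<⇒≤ bigger))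
  ...   | N′ , pN′ , inj₂ (inj₂ (a∉N′ , N′≡N , p , p∈ , p∉N′)) = conclude (pair⁻ p∈)
    where
    maxN′ : Maximum G X N′
    maxN′ = pN′ , λ K pK → ≤-trans (proj₂ maxN K pK) (≤-reflexive (≡-sym N′≡N))
    conclude : p ≡ u ⊎ p ≡ w → u ≡ w
    conclude (inj₁ refl) with refl ← u~a maxN′ p∉N′ a∉N′ = a~w maxM u∉M w∉M
    conclude (inj₂ refl) with refl ← a~w maxN′ a∉N′ p∉N′ = u~a maxM u∉M w∉M

  -- As x is unexposed, a packing N missing x is smaller than M. If it were smaller by only one,
  -- `uncover` would lead to a gain that is too large, or to a packing of the size of N missing both
  -- x and u; sending these two to y would then exceed M.
  stability : ∀ {x u y M} → ¬ Exposed G X x → Maximum G X M → u ∉ cov M →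
    x ∈ X × adj G x y ≡ true → u ∈ X × adj G u y ≡ true →
    ∀ {N} → Packing G X N → x ∉ cov N → 2 + size N ≤ size M
  stability {x} {u} {y} {M} ¬Dx (pM , max) u∉M ex eu {N} pN x∉N with 2 + size N ≤? size M
  ... | yes small = small
  ... | no  large = ⊥-elim impossible
    where
    M≤1+N : size M ≤ 1 + size N
    M≤1+N = s≤s⁻¹ (≰⇒> large)
    below : ∀ {N′} → Packing G X N′ → x ∉ cov N′ → size N′ < size M
    below {N′} pN′ x∉N′ with size M ≤? size N′
    ... | yes M≤N′ = contradiction (N′ , (pN′ , λ K pK → ≤-trans (max K pK) M≤N′) , x∉N′) ¬Dx
    ... | no  M≰N′ = ≰⇒> M≰N′
    bounded : ∀ {N′} → Packing G X N′ → ¬ (2 + size N ≤ size N′)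
    bounded {N′} pN′ bigger = large (≤-trans bigger (max N′ pN′))
    impossible : ⊥
    impossible with uncover ⁅ u ⁆ pN pM x∉N (λ { p p∈ → subst (_∉ cov M) (≡-sym (∈-⁅⁆⁻ p∈)) u∉M })
        (≤-trans (s≤s (below pN x∉N))
          (≤-reflexive (trans (+-comm 1 _)
            (cong (size M +_) (≡-sym (count-⁅⁆ u (∈-⁅⁆ u) λ _ → ∈-⁅⁆⁻))))))
    ... | N′ , pN′ , inj₁ (x∉N′ , bigger) = <⇒≱ (below pN′ x∉N′) (≤-trans M≤1+N bigger)
    ... | N′ , pN′ , inj₂ (inj₁ bigger) = bounded pN′ bigger
    ... | N′ , pN′ , inj₂ (inj₂ (x∉N′ , N′≡N , p , p∈ , p∉N′)) with refl ← ∈-⁅⁆⁻ {a = u} p∈ =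
      let K , pK , bigger = cover-pair pN′ (λ { refl → ¬Dx (M , (pM , max) , u∉M) }) x∉N′ p∉N′ ex eu
      in bounded pK (subst (λ k → 2 + k ≤ size K) N′≡N bigger)

-- Barriers and components

module _ {n : ℕ} (G : Graph n) (X : Fin n → Bool) where

  ExposedClosed : (Fin n → Bool) → Set
  ExposedClosed T = ∀ {x u y} → x ∈ X ∖ T → u ∈ X ∖ T → adj G x y ≡ true → adj G u y ≡ true →
    Exposed G (X ∖ T) u → Exposed G (X ∖ T) x

  -- Since |X| = |T| + |X - T|, the inequality says that every packing of G - T misses more than |T|
  -- vertices of X - T. In this form the right side stays fixed while T grows.
  Barrier : (Fin n → Bool) → Set
  Barrier T = T ⊆ X × (∀ f → Packing G (X ∖ T) f → size f + (count T + count T) < count X)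

  -- Moving x into T raises 2|T| by two; by `stability` the packings that avoid x are at least two
  -- smaller than a maximum one, so the strict inequality persists.
  barrier : (∀ f → Packing G X f → size f < count X) → ∃ λ T → Barrier T × ExposedClosed T
  barrier deficient = grow Barrier ExposedClosed next ∅ ((λ _ ()) , start)
    where
    start : ∀ f → Packing G (X ∖ ∅) f → size f + (count {n} ∅ + count {n} ∅) < count X
    start f pf rewrite count-∅ {n} {∅} (λ _ → refl) | +-identityʳ (size f) =
      deficient f (packing-mono (λ x → proj₁ ∘ ∈-∖⁻ X ∅) pf)

    next : ∀ T → Barrier T → ExposedClosed T ⊎ ∃ λ x → x ∉ T × Barrier (T ∪ ⁅ x ⁆)
    next T (T⊆X , small)
      with any? (λ x → any? λ u → any? λ y →
             (x ∈? X ∖ T) ×-dec (u ∈? X ∖ T) ×-dec (adj G x y Bool.≟ true) ×-dec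
             (adj G u y Bool.≟ true) ×-dec exposed? G (X ∖ T) u ×-dec ¬? (exposed? G (X ∖ T) x))
    ... | no none = inj₁ closed
      where
      closed : ExposedClosed T
      closed {x} {u} {y} x∈ u∈ ex eu Du with exposed? G (X ∖ T) x
      ... | yes Dx = Dx
      ... | no ¬Dx = contradiction (x , u , y , x∈ , u∈ , ex , eu , Du , ¬Dx) none
    ... | yes (x , u , y , x∈ , u∈ , ex , eu , (M , maxM , u∉M) , ¬Dx) =
      inj₂ (x , x∉T , ∪⁅⁆-⊆ T⊆X (proj₁ (∈-∖⁻ X T x∈)) , small′)
      where
      x∉T : x ∉ T
      x∉T = proj₂ (∈-∖⁻ X T x∈)
      T′ = T ∪ ⁅ x ⁆
      smaller : X ∖ T′ ⊆ X ∖ T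
      smaller v h with ∈-∖⁻ X T′ h
      ... | v∈X , v∉T′ with ∈-or-∉ T v
      ...   | inj₁ v∈T = ⊥-elim (∈∉⇒⊥ (∈-∪ˡ T ⁅ x ⁆ v∈T) v∉T′)
      ...   | inj₂ v∉T = ∈-∖ X T v∈X v∉T
      small′ : ∀ f → Packing G (X ∖ T′) f → size f + (count T′ + count T′) < count X
      small′ f pf = ≤-<-trans (begin
        size f + (count T′ + count T′)          ≡⟨ cong (λ k → size f + (k + k)) (count-∪⁅⁆ T x∉T) ⟩
        size f + (suc (count T) + suc (count T)) ≡⟨ regroup (size f) (count T) ⟩
        2 + size f + (count T + count T)        ≤⟨ +-monoˡ-≤ (count T + count T) two-less ⟩
        size M + (count T + count T)            ∎) (small M (proj₁ maxM))
        where
        open ≤-Reasoning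
        open +-*-Solver
        regroup : ∀ s t → s + (suc t + suc t) ≡ 2 + s + (t + t)
        regroup = solve 2 (λ s t → s :+ ((con 1 :+ t) :+ (con 1 :+ t)) := con 2 :+ s :+ (t :+ t)) refl
        x∉f : x ∉ cov f
        x∉f with ∈-or-∉ (cov f) x
        ... | inj₂ x∉f = x∉f
        ... | inj₁ x∈f = ⊥-elim (∈∉⇒⊥ (∈-∪ʳ T ⁅ x ⁆ (∈-⁅⁆ x))
                (proj₂ (∈-∖⁻ X T′ (proj₁ (legal pf (proj₂ (∈cov⇒just {f = f} x∈f)))))))
        two-less : 2 + size f ≤ size M
        two-less = stability ¬Dx maxM u∉M (x∈ , ex) (u∈ , eu) (packing-mono smaller pf) x∉f

  missed-count : ∀ {T M} → Barrier T → Packing G (X ∖ T) M →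
    suc (count T) ≤ count ((X ∖ T) ∖ cov M)
  missed-count {T} {M} (T⊆X , small) pM = +-cancelˡ-< (count T + size M) _ _ (begin-strict
    count T + size M + count T       ≡⟨ regroup (count T) (size M) ⟩
    size M + (count T + count T)     <⟨ small M pM ⟩
    count X                          ≡⟨ ≡-sym (count-∖-⊆ T⊆X) ⟩
    count T + count (X ∖ T)          ≡⟨ cong (count T +_) (≡-sym (count-∖-⊆ covered)) ⟩
    count T + (size M + count ((X ∖ T) ∖ cov M)) ≡⟨ ≡-sym (+-assoc (count T) (size M) _) ⟩
    count T + size M + count ((X ∖ T) ∖ cov M)   ∎)
    where
    open ≤-Reasoning
    open +-*-Solver
    regroup : ∀ t s → t + s + t ≡ s + (t + t)
    regroup = solve 2 (λ t s → t :+ s :+ t := s :+ (t :+ t)) refl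
    covered : cov M ⊆ X ∖ T
    covered x x∈M = proj₁ (legal pM (proj₂ (∈cov⇒just {f = M} x∈M)))

module _ {n : ℕ} {G : Graph n} where

  module _ {W : Fin n → Bool} where

    path-source : ∀ {u v} → Path G W u v → u ∈ W
    path-source (here u∈W)     = u∈W
    path-source (step u∈W _ _) = u∈W

    path-trans : ∀ {u v w} → Path G W u v → Path G W v w → Path G W u w
    path-trans (here _)       q = q
    path-trans (step u∈W e p) q = step u∈W e (path-trans p q)

    path-sym : ∀ {u v} → Path G W u v → Path G W v u
    path-sym (here u∈W) = here u∈W
    path-sym (step {u} {w} u∈W e p) =
      path-trans (path-sym p) (step (path-source p) (trans (Graph.sym G w u) e) (here u∈W))

  path-mono : ∀ {W W′ u v} → W ⊆ W′ → Path G W u v → Path G W′ u v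
  path-mono W⊆W′ (here u∈W)     = here (W⊆W′ _ u∈W)
  path-mono W⊆W′ (step u∈W e p) = step (W⊆W′ _ u∈W) e (path-mono W⊆W′ p)

  component : ∀ W {u} → u ∈ W → ∃ λ R → IsComponent G W R × u ∈ R
  component W {u} u∈W with grow Reached Closed next ⁅ u ⁆ start
    where
    Reached Closed : (Fin n → Bool) → Set
    Reached R = u ∈ R × R ⊆ W × (∀ v → v ∈ R → Path G R u v)
    Closed R = ∀ r w → r ∈ R → w ∈ W → adj G r w ≡ true → w ∈ R
    start : Reached ⁅ u ⁆
    start = ∈-⁅⁆ u , (λ v v∈ → subst (_∈ W) (≡-sym (∈-⁅⁆⁻ v∈)) u∈W)
          , λ v v∈ → subst (Path G ⁅ u ⁆ u) (≡-sym (∈-⁅⁆⁻ v∈)) (here (∈-⁅⁆ u))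
    next : ∀ R → Reached R → Closed R ⊎ ∃ λ w → w ∉ R × Reached (R ∪ ⁅ w ⁆)
    next R (u∈R , R⊆W , reach)
      with any? (λ r → any? λ w → (r ∈? R) ×-dec (w ∈? W) ×-dec (adj G r w Bool.≟ true) ×-dec (R w Bool.≟ false))
    ... | no none = inj₁ closed
      where
      closed : Closed R
      closed r w r∈R w∈W e with ∈-or-∉ R w
      ... | inj₁ w∈R = w∈R
      ... | inj₂ w∉R = contradiction (r , w , r∈R , w∈W , e , w∉R) none
    ... | yes (r , w , r∈R , w∈W , e , w∉R) =
      inj₂ (w , w∉R , R⊆R′ u u∈R , ∪⁅⁆-⊆ R⊆W w∈W , reach′)
      where
      R′ = R ∪ ⁅ w ⁆
      R⊆R′ : R ⊆ R′
      R⊆R′ x = ∈-∪ˡ R ⁅ w ⁆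
      reach′ : ∀ v → v ∈ R′ → Path G R′ u v
      reach′ v v∈ with ∈-∪⁻ R ⁅ w ⁆ v∈
      ... | inj₁ v∈R = path-mono R⊆R′ (reach v v∈R)
      ... | inj₂ v∈w with refl ← ∈-⁅⁆⁻ {a = w} v∈w = path-trans (path-mono R⊆R′ (reach r r∈R))
              (step (R⊆R′ r r∈R) e (here v∈))
  ... | R , (u∈R , R⊆W , reach) , closed =
    R , (R⊆W , ((u , u∈R) , λ v w v∈R w∈R → path-trans (path-sym (reach v v∈R)) (reach w w∈R)) , closed) , u∈R

  -- A path inside R cannot leave the closed set R′. Used in both directions, this makes components
  -- with a common vertex equal.
  component-⊆ : ∀ {W R R′ v} → IsComponent G W R → IsComponent G W R′ → v ∈ R → v ∈ R′ → R ⊆ R′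
  component-⊆ {W} {R} {R′} {v} (R⊆W , (_ , conn) , _) (_ , _ , closed′) v∈R v∈R′ w w∈R =
    follow (conn v w v∈R w∈R) v∈R′
    where
    follow : ∀ {a b} → Path G R a b → a ∈ R′ → b ∈ R′
    follow (here _) a∈ = a∈
    follow (step _ e p) a∈ = follow p (closed′ _ _ a∈ (R⊆W _ (path-source p)) e)

-- Exposure and series classes along paths

module Bipartite {n : ℕ} (G : Graph n) (side : Fin n → Bool) (bip : IsBipartition G side) where

  neighbour-∉ : ∀ {u v} → adj G u v ≡ true → u ∈ side → v ∉ side
  neighbour-∉ e u∈ = Bool.¬-not λ v∈ → bip _ _ e (trans u∈ (≡-sym v∈))

  neighbour-∈ : ∀ {u v} → adj G u v ≡ true → u ∉ side → v ∈ side
  neighbour-∈ e u∉ = Bool.¬-not λ v∉ → bip _ _ e (trans u∉ (≡-sym v∉))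

  adj-sym : ∀ {u v} → adj G u v ≡ true → adj G v u ≡ true
  adj-sym {u} {v} = trans (Graph.sym G v u)

  module _ {T R : Fin n → Bool} (R⊆W : R ⊆ minus T) where

    private X = side ∖ T

    in-X : ∀ {v} → v ∈ R → v ∈ side → v ∈ X
    in-X v∈R v∈side = ∈-∖ side T v∈side (Bool.not-injective {y = false} (R⊆W _ v∈R))

    module _ (closed : ExposedClosed G side T) where

      -- Induction along a path that alternates between the two sides. At a vertex of X the
      -- invariant holds for that vertex, at a vertex of Y for all its neighbours in X. Passing from
      -- X to Y, closure of T carries exposure over, and `adjacent-series` with `series-trans`
      -- carries the series relation.
      spread : ∀ {u a b} → Path G R a b →
        (a ∈ side → Exposed G X a × Series G X u a) →
        (a ∉ side → ∀ x → x ∈ X → adj G x a ≡ true → Exposed G X x × Series G X u x) →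
        b ∈ side → Exposed G X b × Series G X u b
      spread (here _) onX _ b∈ = onX b∈
      spread {u} {a} (step {w = w} a∈R e p) onX onY with ∈-or-∉ side a
      ... | inj₂ a∉ = spread p
        (λ w∈ → onY a∉ w (in-X (path-source p) w∈) (adj-sym e))
        (λ w∉ → ⊥-elim (∈∉⇒⊥ (neighbour-∈ e a∉) w∉))
      ... | inj₁ a∈ = spread p
        (λ w∈ → ⊥-elim (∈∉⇒⊥ w∈ (neighbour-∉ e a∈)))
        λ _ x x∈X ex → closed x∈X a∈X ex e (proj₁ (onX a∈))
                     , series-trans (proj₁ (onX a∈)) (proj₂ (onX a∈)) (adjacent-series (a∈X , e) (x∈X , ex))
        where
        a∈X : a ∈ X
        a∈X = in-X a∈R a∈

      spread-from : ∀ {u v} → Path G R u v → u ∈ side → Exposed G X u → v ∈ side →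
        Exposed G X v × Series G X u v
      spread-from p u∈ Du = spread p (λ _ → Du , λ _ _ _ → refl) λ u∉ → ⊥-elim (∈∉⇒⊥ u∈ u∉)

-- Spanning subgraphs and L-critical components

inL⇒defic : ∀ s d → inL s (pos d) → defic s d ≡ 0
inL⇒defic true  _ (inj₂ refl) = refl
inL⇒defic false _ (inj₁ refl) = refl
inL⇒defic false _ (inj₂ (+≤+ (s≤s (s≤s _)))) = refl

defic⇒inL : ∀ s d → defic s d ≡ 0 → inL s (pos d)
defic⇒inL true  1 _ = inj₂ refl
defic⇒inL false 0 _ = inj₁ refl
defic⇒inL false (suc (suc d)) _ = inj₂ (+≤+ (s≤s (s≤s z≤n)))

defic-X : ∀ d → defic true d ≡ 0 → d ≡ 1
defic-X 1 _ = refl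

defic-Y : ∀ d → defic false d ≡ 0 → 1 ≤ d → 2 ≤ d
defic-Y (suc (suc d)) _ _ = s≤s (s≤s z≤n)

defic-≥2 : ∀ {d} → 2 ≤ d → defic false d ≡ 0
defic-≥2 (s≤s (s≤s _)) = refl

module Critical {n : ℕ} (G : Graph n) (side : Fin n → Bool) (bip : IsBipartition G side) where
  open Bipartite G side bip

  module _ {W : Fin n → Bool} where

    deficAt : Spanning G W → Fin n → ℕ
    deficAt F v = defic (side v) (deg F v)

    nabla-0 : ∀ F → (∀ v → v ∈ W → deficAt F v ≡ 0) → nabla G side W F ≡ 0
    nabla-0 F h = sumFin-0 at
      where
      at : ∀ v → (if W v then deficAt F v else 0) ≡ 0
      at v with W v in eq
      ... | true  = h v eq
      ... | false = refl

    nabla-0⁻ : ∀ F → nabla G side W F ≡ 0 → ∀ v → v ∈ W → deficAt F v ≡ 0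
    nabla-0⁻ F h v v∈W = trans (cong (λ b → if b then deficAt F v else 0) (≡-sym v∈W)) (sumFin-0⁻ h v)

    nabla-1 : ∀ F a → a ∈ W → deficAt F a ≡ 1 → (∀ v → v ∈ W → v ≢ a → deficAt F v ≡ 0) →
      nabla G side W F ≡ 1
    nabla-1 F a a∈W one h = trans (sumFin-single a at)
      (trans (cong (λ b → if b then deficAt F a else 0) a∈W) one)
      where
      at : ∀ v → v ≢ a → (if W v then deficAt F v else 0) ≡ 0
      at v v≢a with W v in eq
      ... | true  = h v eq v≢a
      ... | false = refl

    module _ (F : Spanning G W) where

      edge-adj : ∀ {u v} → edge F u v ≡ true → adj G u v ≡ true
      edge-adj e = proj₁ (sub F _ _ e)

      choose : Fin n → Maybe (Fin n)
      choose x with (x ∈? side) ×-dec any? (λ y → edge F x y Bool.≟ true)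
      ... | yes (_ , y , _) = just y
      ... | no  _ = nothing

      choose⇒edge : ∀ {x y} → choose x ≡ just y → x ∈ side × edge F x y ≡ true
      choose⇒edge {x} eq with (x ∈? side) ×-dec any? (λ y → edge F x y Bool.≟ true)
      choose⇒edge refl | yes (x∈ , _ , e) = x∈ , e

      -- Deficiency 0 on X means degree 1, so the arbitrary edge picked by `choose` is the only one.
      edge⇒choose : ∀ {x y} → x ∈ side → edge F x y ≡ true → deficAt F x ≡ 0 → choose x ≡ just y
      edge⇒choose {x} {y} x∈ e d≡0 with (x ∈? side) ×-dec any? (λ y → edge F x y Bool.≟ true)
      ... | no none = contradiction (x∈ , y , e) none
      ... | yes (_ , z , e′) = cong just (count≡1⇒unique {P = edge F x} deg≡1 e′ e)
        where
        deg≡1 : deg F x ≡ 1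
        deg≡1 = defic-X _ (trans (cong (λ s → defic s (deg F x)) (≡-sym x∈)) d≡0)

      choice : Assignment n
      choice = tabulate choose

      choice⇒choose : ∀ {x y} → lookup choice x ≡ just y → choose x ≡ just y
      choice⇒choose {x} = trans (≡-sym (lookup∘tabulate choose x))

      choice-∈W : ∀ {x} → x ∈ cov choice → x ∈ W
      choice-∈W {x} x∈ = proj₁ (proj₂ (sub F _ _ (proj₂ (choose⇒edge (choice⇒choose
        (proj₂ (∈cov⇒just {f = choice} x∈)))))))

      module _ (factor : ∀ v → v ∈ W → deficAt F v ≡ 0) where

        -- A chosen y has positive degree in the factor, hence degree at least 2, and a second
        -- neighbour of y must also choose y.
        choice-packing : Packing G side choice
        choice-packing .legal eq = let x∈ , e = choose⇒edge (choice⇒choose eq) in x∈ , edge-adj e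
        choice-packing .mate {x} {y} eq with choose⇒edge (choice⇒choose eq)
        ... | x∈ , e with sub F _ _ e
        ...   | xy , _ , y∈W with count≥2⇒other {P = edge F y} deg≥2 x
          where
          y∉ : y ∉ side
          y∉ = neighbour-∉ xy x∈
          ex : edge F y x ≡ true
          ex = trans (esym F y x) e
          deg≥2 : 2 ≤ deg F y
          deg≥2 = defic-Y _ (trans (cong (λ s → defic s (deg F y)) (≡-sym y∉)) (factor y y∈W))
            (≤-trans (≤-reflexive (≡-sym (count-⁅⁆ x (∈-⁅⁆ x) λ _ → ∈-⁅⁆⁻)))
              (count-mono {n} {⁅ x ⁆} {edge F y} λ v v∈ → subst (_∈ edge F y) (≡-sym (∈-⁅⁆⁻ v∈)) ex))
        ...     | x′ , x′≢x , e′ with sub F _ _ e′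
        ...       | yx′ , _ , x′∈W = x′ , x′≢x , trans (lookup∘tabulate choose x′)
          (edge⇒choose (neighbour-∈ yx′ (neighbour-∉ xy x∈)) (trans (esym F x′ y) e′) (factor x′ x′∈W))

        choice-covers : ∀ {x} → x ∈ W → x ∈ side → x ∈ cov choice
        choice-covers {x} x∈W x∈ = just⇒∈cov {f = choice}
          (trans (lookup∘tabulate choose x) (edge⇒choose x∈ (proj₂ ∃edge) (factor x x∈W)))
          where
          ∃edge : ∃ λ y → edge F x y ≡ true
          ∃edge = count≥1⇒∃ {P = edge F x} (≤-reflexive (≡-sym
            (defic-X _ (trans (cong (λ s → defic s (deg F x)) (≡-sym x∈)) (factor x x∈W)))))

  module _ {R : Fin n → Bool} (f : Assignment n)
    (f-legal : ∀ {x y} → lookup f x ≡ just y →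
      x ∈ side × adj G x y ≡ true × (x ∈ R → y ∈ R) × (y ∈ R → x ∈ R)) where

    private
      Edge : Fin n → Fin n → Set
      Edge u v = (u ∈ R × v ∈ R) × (lookup f u ≡ just v ⊎ lookup f v ≡ just u)

      edge? : ∀ u v → Dec (Edge u v)
      edge? u v = ((u ∈? R) ×-dec (v ∈? R)) ×-dec ((lookup f u ≟ᴹ just v) ⊎-dec (lookup f v ≟ᴹ just u))

      flip-edge : ∀ {u v} → Edge u v → Edge v u
      flip-edge ((u∈ , v∈) , e) = (v∈ , u∈) , [ inj₂ , inj₁ ]′ e

    -- The assumption on f is legality together with not crossing the boundary of R, so that degrees
    -- inside R can be read off f. It also admits the assignment of `critical-Y`, which hits one y
    -- exactly once and so is no packing.
    graphOf : Spanning G R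
    graphOf .edge u v = does (edge? u v)
    graphOf .esym u v = does-⇔ (mk⇔ flip-edge flip-edge) (edge? u v) (edge? v u)
    graphOf .sub u v h with does-true (edge? u v) h
    ... | (u∈ , v∈) , inj₁ eq = proj₁ (proj₂ (f-legal eq)) , u∈ , v∈
    ... | (u∈ , v∈) , inj₂ eq = adj-sym (proj₁ (proj₂ (f-legal eq))) , u∈ , v∈

    private
      from-X : ∀ {u v} → u ∈ side → edge graphOf u v ≡ true → lookup f u ≡ just v
      from-X {u} {v} u∈ h with does-true (edge? u v) h
      ... | _ , inj₁ eq = eq
      ... | _ , inj₂ eq = let v∈ , e , _ = f-legal eq in ⊥-elim (∈∉⇒⊥ u∈ (neighbour-∉ e v∈))

      from-Y : ∀ {u v} → u ∉ side → edge graphOf u v ≡ true → lookup f v ≡ just u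
      from-Y {u} {v} u∉ h with does-true (edge? u v) h
      ... | _ , inj₂ eq = eq
      ... | _ , inj₁ eq = ⊥-elim (∈∉⇒⊥ (proj₁ (f-legal eq)) u∉)

      to-Y : ∀ {u v} → u ∈ R → lookup f v ≡ just u → edge graphOf u v ≡ true
      to-Y {u} {v} u∈R eq = dec-true (edge? u v) ((u∈R , proj₂ (proj₂ (proj₂ (f-legal eq))) u∈R) , inj₂ eq)

    deg-uncovered : ∀ {u} → u ∈ side → u ∉ cov f → deg graphOf u ≡ 0
    deg-uncovered {u} u∈ u∉f = count-∅ {n} {edge graphOf u} λ v →
      Bool.¬-not λ e → ∈∉⇒⊥ (just⇒∈cov {f = f} (from-X u∈ e)) u∉f

    deg-covered : ∀ {u} → u ∈ R → u ∈ side → u ∈ cov f → deg graphOf u ≡ 1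
    deg-covered {u} u∈R u∈ u∈f with ∈cov⇒just {f = f} u∈f
    ... | v , eq = count-⁅⁆ v
      (dec-true (edge? u v) ((u∈R , proj₁ (proj₂ (proj₂ (f-legal eq))) u∈R) , inj₁ eq))
      λ w e → Maybe.just-injective (trans (≡-sym (from-X u∈ e)) eq)

    deg-single : ∀ {u x} → u ∈ R → u ∉ side → lookup f x ≡ just u →
      (∀ z → lookup f z ≡ just u → z ≡ x) → deg graphOf u ≡ 1
    deg-single {x = x} u∈R u∉ eq only = count-⁅⁆ x (to-Y u∈R eq) λ z e → only z (from-Y u∉ e)

    defic-covered : ∀ {u} → u ∈ R → u ∈ side → u ∈ cov f → deficAt graphOf u ≡ 0
    defic-covered u∈R u∈ u∈f = cong₂ defic u∈ (deg-covered u∈R u∈ u∈f)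

    defic-value : ∀ {u} → u ∈ R → u ∉ side →
      (∀ {x} → lookup f x ≡ just u → ∃ λ x′ → x′ ≢ x × lookup f x′ ≡ just u) →
      deficAt graphOf u ≡ 0
    defic-value {u} u∈R u∉ partner with any? (λ x → lookup f x ≟ᴹ just u)
    ... | no none = cong₂ defic u∉ (count-∅ λ v → Bool.¬-not λ e → none (v , from-Y u∉ e))
    ... | yes (x , eq) = let x′ , x′≢x , eq′ = partner eq in
      trans (cong (λ s → defic s (deg graphOf u)) u∉)
        (defic-≥2 (count≥2 (≢-sym x′≢x) (to-Y u∈R eq) (to-Y u∈R eq′)))

  -- Components of G - T containing a missed vertex

  module _ {T R : Fin n → Bool} (T⊆X : T ⊆ side) (isComp : IsComponent G (minus T) R) where

    private
      X = side ∖ T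
      R⊆W = proj₁ isComp
      R-closed = proj₂ (proj₂ isComp)

      Y⊆W : ∀ {y} → y ∉ side → y ∈ minus T
      Y⊆W y∉ = cong not (Bool.¬-not λ y∈T → ∈∉⇒⊥ (T⊆X _ y∈T) y∉)

      X⊆W : ∀ {x} → x ∈ X → x ∈ minus T
      X⊆W x∈ = cong not (proj₂ (∈-∖⁻ side T x∈))

      crosses : ∀ {x y} → x ∈ X → adj G x y ≡ true → (x ∈ R → y ∈ R) × (y ∈ R → x ∈ R)
      crosses {x} {y} x∈X e =
          (λ x∈R → R-closed x y x∈R (Y⊆W (neighbour-∉ e (proj₁ (∈-∖⁻ side T x∈X)))) e)
        , λ y∈R → R-closed y x y∈R (X⊆W x∈X) (adj-sym e)

      packing-legal : ∀ {N x y} → Packing G X N → lookup N x ≡ just y →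
        x ∈ side × adj G x y ≡ true × (x ∈ R → y ∈ R) × (y ∈ R → x ∈ R)
      packing-legal pN eq = let x∈X , e = legal pN eq in proj₁ (∈-∖⁻ side T x∈X) , e , crosses x∈X e

    module _ {M u} (maxM : Maximum G X M) (u∈R : u ∈ R) (u∈side : u ∈ side) (u∉M : u ∉ cov M) where

      -- Replacing M on R by an L-factor of R would keep everything that M covers and add u, against
      -- maximality.
      no-factor : ∀ (F : Spanning G R) → 1 ≤ nabla G side R F
      no-factor F with nabla G side R F in eq
      ... | suc _ = s≤s z≤n
      ... | zero  = ⊥-elim (<⇒≱ larger (proj₂ maxM K pK))
        where
        factor : ∀ v → v ∈ R → deficAt F v ≡ 0
        factor = nabla-0⁻ F eq
        f = choice F
        K : Assignment n
        K = override R (lookup f) M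
        at-R : ∀ {x} → x ∈ R → lookup K x ≡ lookup f x
        at-R = override-∈
        off-R : ∀ {x} → x ∉ R → lookup K x ≡ lookup M x
        off-R = override-∉ {g = lookup f}
        pf = choice-packing F factor
        pK : Packing G X K
        pK .legal {x} eq with ∈-or-∉ R x
        ... | inj₁ x∈R = let x∈ , e = legal pf (trans (≡-sym (at-R x∈R)) eq) in in-X {T} R⊆W x∈R x∈ , e
        ... | inj₂ x∉R = legal (proj₁ maxM) (trans (≡-sym (off-R x∉R)) eq)
        pK .mate {x} {y} eq with ∈-or-∉ R x
        ... | inj₁ x∈R =
          let x′ , x′≢x , eq′ = mate pf (trans (≡-sym (at-R x∈R)) eq)
          in x′ , x′≢x , trans (at-R (choice-∈W F (just⇒∈cov {f = f} eq′))) eq′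
        ... | inj₂ x∉R with mate (proj₁ maxM) (trans (≡-sym (off-R x∉R)) eq)
        ...   | x′ , x′≢x , eq′ with ∈-or-∉ R x′
        ...     | inj₂ x′∉R = x′ , x′≢x , trans (off-R x′∉R) eq′
        ...     | inj₁ x′∈R = ⊥-elim (∈∉⇒⊥ (back (forth x′∈R)) x∉R)
          where
          forth : x′ ∈ R → y ∈ R
          forth = proj₁ (proj₂ (proj₂ (packing-legal (proj₁ maxM) eq′)))
          back : y ∈ R → x ∈ R
          back = proj₂ (proj₂ (proj₂ (packing-legal (proj₁ maxM) (trans (≡-sym (off-R x∉R)) eq))))
        covers : ∀ {x} → x ∈ R → x ∈ side → x ∈ cov K
        covers x∈R x∈ = trans (cong is-just (at-R x∈R)) (choice-covers F factor x∈R x∈)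
        M⊆K : cov M ⊆ cov K
        M⊆K x x∈M with ∈-or-∉ R x
        ... | inj₁ x∈R = covers x∈R (proj₁ (packing-legal (proj₁ maxM) (proj₂ (∈cov⇒just {f = M} x∈M))))
        ... | inj₂ x∉R = trans (cong is-just (off-R x∉R)) x∈M
        larger : size M < size K
        larger = count-<-mono u M⊆K u∉M (covers u∈R u∈side)

      module _ (exposed : ∀ {v} → v ∈ R → v ∈ side → Exposed G X v)
               (series : ∀ {v w} → v ∈ R → v ∈ side → w ∈ R → w ∈ side → Series G X v w) where

        private
          optimal : ∀ {F} → nabla G side R F ≡ 1 → Optimal G side R F
          optimal eq F′ = ≤-trans (≤-reflexive eq) (no-factor F′)

        critical-X : ∀ {x} → x ∈ R → x ∈ side → ∃ λ F → Optimal G side R F × deg F x ≡ 0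
        critical-X {x} x∈R x∈ with exposed x∈R x∈
        ... | N , maxN , x∉N = F , optimal {F} (nabla-1 F x x∈R (cong₂ defic x∈ deg≡0) others) , deg≡0
          where
          F : Spanning G R
          F = graphOf N (packing-legal (proj₁ maxN))
          deg≡0 : deg F x ≡ 0
          deg≡0 = deg-uncovered N (packing-legal (proj₁ maxN)) x∈ x∉N
          others : ∀ v → v ∈ R → v ≢ x → deficAt F v ≡ 0
          others v v∈R v≢x with ∈-or-∉ side v
          ... | inj₂ v∉ = defic-value N (packing-legal (proj₁ maxN)) v∈R v∉ (mate (proj₁ maxN))
          ... | inj₁ v∈ with ∈-or-∉ (cov N) v
          ...   | inj₁ v∈N = defic-covered N (packing-legal (proj₁ maxN)) v∈R v∈ v∈N
          ...   | inj₂ v∉N = contradiction (series v∈R v∈ x∈R x∈ maxN v∉N x∉N) v≢x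

        critical-Y : ∀ {y} → y ∈ R → y ∉ side → ∃ λ F → Optimal G side R F × deg F y ≡ 1
        critical-Y {y} y∈R y∉ with proj₂ (proj₁ (proj₂ isComp)) y u y∈R u∈R
        ... | here _ = ⊥-elim (∈∉⇒⊥ u∈side y∉)
        ... | step {w = w} _ yw p with exposed (path-source p) (neighbour-∈ yw y∉)
        ...   | N , (pN , max) , w∉N = F , optimal {F} (nabla-1 F y y∈R (cong₂ defic y∉ deg≡1) others) , deg≡1
          where
          w∈R : w ∈ R
          w∈R = path-source p
          w∈ : w ∈ side
          w∈ = neighbour-∈ yw y∉
          unused : ∀ {z} → lookup N z ≢ just y
          unused eq = <⇒≱ (count-<-mono w cov-assign-⊇ w∉N (cov-assign-∈ (∈-⁅⁆ w)))
            (max _ (assign-one pN w∉N (in-X {T} R⊆W w∈R w∈) (adj-sym yw) eq))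
          f : Assignment n
          f = assign ⁅ w ⁆ y N
          fw : lookup f w ≡ just y
          fw = assign-∈ (∈-⁅⁆ w)
          f-legal : ∀ {x v} → lookup f x ≡ just v →
            x ∈ side × adj G x v ≡ true × (x ∈ R → v ∈ R) × (v ∈ R → x ∈ R)
          f-legal {x} eq with x ≟ w
          ... | no x≢w = packing-legal pN (trans (≡-sym (assign-∉ (∉-⁅⁆ x≢w))) eq)
          ... | yes refl with refl ← trans (≡-sym fw) eq = w∈ , adj-sym yw , const y∈R , const w∈R
          only : ∀ z → lookup f z ≡ just y → z ≡ w
          only z eq with z ≟ w
          ... | yes z≡w = z≡w
          ... | no  z≢w = contradiction (trans (≡-sym (assign-∉ (∉-⁅⁆ z≢w))) eq) unused
          F : Spanning G R
          F = graphOf f f-legal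
          deg≡1 : deg F y ≡ 1
          deg≡1 = deg-single f f-legal y∈R y∉ fw only
          others : ∀ v → v ∈ R → v ≢ y → deficAt F v ≡ 0
          others v v∈R v≢y with ∈-or-∉ side v
          ... | inj₂ v∉ = defic-value f f-legal v∈R v∉ partner
            where
            partner : ∀ {x} → lookup f x ≡ just v → ∃ λ x′ → x′ ≢ x × lookup f x′ ≡ just v
            partner {x} eq with x ≟ w
            ... | yes refl = contradiction (Maybe.just-injective (trans (≡-sym eq) fw)) v≢y
            ... | no  x≢w with mate pN (trans (≡-sym (assign-∉ (∉-⁅⁆ x≢w))) eq)
            ...   | x′ , x′≢x , eq′ = x′ , x′≢x , trans (assign-∉ (∉-⁅⁆ x′≢w)) eq′
              where
              x′≢w : x′ ≢ w
              x′≢w refl = ∈∉⇒⊥ (just⇒∈cov {f = N} eq′) w∉N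
          ... | inj₁ v∈ with ∈-or-∉ (cov N) v
          ...   | inj₁ v∈N = defic-covered f f-legal v∈R v∈ (cov-assign-⊇ v v∈N)
          ...   | inj₂ v∉N with refl ← series v∈R v∈ w∈R w∈ (pN , max) v∉N w∉N =
            defic-covered f f-legal v∈R v∈ (cov-assign-∈ (∈-⁅⁆ w))

        component-critical : LCritical G side R
        component-critical = proj₁ (proj₂ isComp) , λ v v∈R → inD v v∈R (∈-or-∉ side v)
          where
          inD : ∀ v → v ∈ R → v ∈ side ⊎ v ∉ side → InD G side R v
          inD v v∈R (inj₁ v∈) with critical-X v∈R v∈
          ... | F , opt , deg≡0 = (λ (_ , ge) → ¬ge (transport geMaxL (ge F opt)))
                                , (λ (_ , le) → ¬le (transport leMinL (le F opt)))
                                , λ inC → ¬in (transport inL (inC F opt))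
            where
            transport : ∀ (P : Bool → ℤ → Set) → P (side v) (pos (deg F v)) → P true (pos 0)
            transport P h = subst (P true) (cong pos deg≡0) (subst (λ s → P s (pos (deg F v))) v∈ h)
            ¬ge : ¬ geMaxL true (pos 0)
            ¬ge (+≤+ ())
            ¬le : ¬ leMinL true (pos 0)
            ¬le ()
            ¬in : ¬ inL true (pos 0)
            ¬in (inj₁ ())
            ¬in (inj₂ ())
          inD v v∈R (inj₂ v∉) with critical-Y v∈R v∉
          ... | F , opt , deg≡1 = (λ (_ , ge) → transport geMaxL (ge F opt))
                                , (λ (_ , le) → ¬le (transport leMinL (le F opt)))
                                , λ inC → ¬in (transport inL (inC F opt))
            where
            transport : ∀ (P : Bool → ℤ → Set) → P (side v) (pos (deg F v)) → P false (pos 1)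
            transport P h = subst (P false) (cong pos deg≡1) (subst (λ s → P s (pos (deg F v))) v∉ h)
            ¬le : ¬ leMinL false (pos 1)
            ¬le (+≤+ ())
            ¬in : ¬ inL false (pos 1)
            ¬in (inj₁ ())
            ¬in (inj₂ (+≤+ (s≤s ())))

  covering-packing⇒factor : ∀ f → Packing G side f → side ⊆ cov f → HasLFactor G side
  covering-packing⇒factor f pf covers = F , λ v → defic⇒inL _ _ (at v (∈-or-∉ side v))
    where
    f-legal : ∀ {x y} → lookup f x ≡ just y →
      x ∈ side × adj G x y ≡ true × (x ∈ full → y ∈ full) × (y ∈ full → x ∈ full)
    f-legal eq = let x∈ , e = legal pf eq in x∈ , e , const refl , const refl
    F : Spanning G full
    F = graphOf f f-legal
    at : ∀ v → v ∈ side ⊎ v ∉ side → deficAt F v ≡ 0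
    at v (inj₁ v∈) = defic-covered f f-legal refl v∈ (covers v v∈)
    at v (inj₂ v∉) = defic-value f f-legal refl v∉ (mate pf)

  module _ (few : ∀ S → S ⊆ side → QAtMost G side S (count S)) where

    deficient-impossible : ¬ (∀ f → Packing G side f → size f < count side)
    deficient-impossible deficient with barrier G side deficient
    ... | T , bar@(T⊆X , _) , closed with ∃maximum G (side ∖ T)
    ...   | M , maxM with count-enumerate (suc (count T)) _ (missed-count G side bar (proj₁ maxM))
    ...     | h , h-inj , h∈ =
      <⇒≱ (n<1+n (count T)) (few T T⊆X (suc (count T)) R distinct λ i → isComp i , critical i)
      where
      X = side ∖ T
      h∈X : ∀ i → h i ∈ X
      h∈X i = proj₁ (∈-∖⁻ X (cov M) (h∈ i))
      h∈side : ∀ i → h i ∈ side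
      h∈side i = proj₁ (∈-∖⁻ side T (h∈X i))
      h∉M : ∀ i → h i ∉ cov M
      h∉M i = proj₂ (∈-∖⁻ X (cov M) (h∈ i))
      h∉T : ∀ i → h i ∈ minus T
      h∉T i = cong not (proj₂ (∈-∖⁻ side T (h∈X i)))
      R : Fin (suc (count T)) → Fin n → Bool
      R i = proj₁ (component (minus T) (h∉T i))
      isComp : ∀ i → IsComponent G (minus T) (R i)
      isComp i = proj₁ (proj₂ (component (minus T) (h∉T i)))
      h∈R : ∀ i → h i ∈ R i
      h∈R i = proj₂ (proj₂ (component (minus T) (h∉T i)))
      reach : ∀ i {v w} → v ∈ R i → w ∈ R i → v ∈ side → Exposed G X v → w ∈ side →
        Exposed G X w × Series G X v w
      reach i v∈R w∈R = spread-from (proj₁ (isComp i)) closed (proj₂ (proj₁ (proj₂ (isComp i))) _ _ v∈R w∈R)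
      exposed : ∀ i {v} → v ∈ R i → v ∈ side → Exposed G X v
      exposed i v∈R v∈ = proj₁ (reach i (h∈R i) v∈R (h∈side i) (M , maxM , h∉M i) v∈)
      series : ∀ i {v w} → v ∈ R i → v ∈ side → w ∈ R i → w ∈ side → Series G X v w
      series i v∈R v∈ w∈R w∈ = proj₂ (reach i v∈R w∈R v∈ (exposed i v∈R v∈) w∈)
      critical : ∀ i → LCritical G side (R i)
      critical i = component-critical T⊆X (isComp i) maxM (h∈R i) (h∈side i) (h∉M i) (exposed i) (series i)
      distinct : ∀ i j → i ≢ j → ∃ λ v → R i v ≢ R j v
      distinct i j i≢j = h i , λ eq → i≢j (h-inj
        (series j (trans (≡-sym eq) (h∈R i)) (h∈side i) (h∈R j) (h∈side j) maxM (h∉M i) (h∉M j)))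

    factor-exists : HasLFactor G side
    factor-exists with ∃Assignment? (λ f → packing? G side f ×-dec (count side ≤? size f))
    ... | no none = ⊥-elim (deficient-impossible λ f pf → ≰⇒> λ large → none (f , pf , large))
    ... | yes (f , pf , large) = covering-packing⇒factor f pf covers
      where
      f⊆side : cov f ⊆ side
      f⊆side x x∈f = proj₁ (legal pf (proj₂ (∈cov⇒just {f = f} x∈f)))
      covers : side ⊆ cov f
      covers x x∈ with ∈-or-∉ (cov f) x
      ... | inj₁ x∈f = x∈f
      ... | inj₂ x∉f = contradiction large (<⇒≱ (count-<-mono x f⊆side x∉f x∈))

  critical⇒no-factor : ∀ {R} → LCritical G side R → ∀ (F : Spanning G R) →
    ¬ (∀ v → v ∈ R → deficAt F v ≡ 0)
  critical⇒no-factor (((v , v∈R) , _) , inD) F factor = proj₂ (proj₂ (inD v v∈R)) λ F′ opt →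
    defic⇒inL _ _ (nabla-0⁻ F′ (n≤0⇒n≡0 (subst (nabla G side _ F′ ≤_) (nabla-0 F factor) (opt F))) v v∈R)

  module _ (F : Spanning G full) (factor : ∀ v → inL (side v) (pos (deg F v)))
           {S : Fin n → Bool} (S⊆X : S ⊆ side) where

    edge-to-S : ∀ {R} → IsComponent G (minus S) R → LCritical G side R →
      ∃ λ s → ∃ λ r → s ∈ S × r ∈ R × edge F s r ≡ true
    edge-to-S {R} isComp crit
      with any? (λ s → any? λ r → (s ∈? S) ×-dec (r ∈? R) ×-dec (edge F s r Bool.≟ true))
    ... | yes found = found
    ... | no none = ⊥-elim (critical⇒no-factor crit F′ λ v v∈R →
            trans (cong (defic (side v)) (deg-same v v∈R)) (inL⇒defic _ _ (factor v)))
      where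
      Edge : Fin n → Fin n → Set
      Edge u v = u ∈ R × v ∈ R × edge F u v ≡ true
      edge? : ∀ u v → Dec (Edge u v)
      edge? u v = (u ∈? R) ×-dec (v ∈? R) ×-dec (edge F u v Bool.≟ true)
      flip-edge : ∀ {u v} → Edge u v → Edge v u
      flip-edge {u} {v} (u∈ , v∈ , e) = v∈ , u∈ , trans (esym F v u) e
      F′ : Spanning G R
      F′ .edge u v = does (edge? u v)
      F′ .esym u v = does-⇔ (mk⇔ flip-edge flip-edge) (edge? u v) (edge? v u)
      F′ .sub u v h = let u∈ , v∈ , e = does-true (edge? u v) h in proj₁ (sub F u v e) , u∈ , v∈
      deg-same : ∀ v → v ∈ R → deg F′ v ≡ deg F v
      deg-same v v∈R = count-cong
        (λ w h → proj₂ (proj₂ (does-true (edge? v w) h)))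
        λ w e → dec-true (edge? v w) (v∈R , stays w e (∈-or-∉ S w) , e)
        where
        stays : ∀ w → edge F v w ≡ true → w ∈ S ⊎ w ∉ S → w ∈ R
        stays w e (inj₁ w∈S) = contradiction (w , v , w∈S , v∈R , trans (esym F w v) e) none
        stays w e (inj₂ w∉S) = proj₂ (proj₂ isComp) v w v∈R (cong not w∉S) (proj₁ (sub F v w e))

    few-critical : QAtMost G side S (count S)
    few-critical m R distinct comp = count-injection s s-inj λ i → proj₁ (proj₂ (proj₂ (found i)))
      where
      found : ∀ i → ∃ λ s → ∃ λ r → s ∈ S × r ∈ R i × edge F s r ≡ true
      found i = edge-to-S (proj₁ (comp i)) (proj₂ (comp i))
      s : Fin m → Fin n
      s i = proj₁ (found i)
      s-inj : Injective _≡_ _≡_ s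
      s-inj {i} {j} eq with i ≟ j
      ... | yes i≡j = i≡j
      ... | no  i≢j = contradiction agree (proj₂ (distinct i j i≢j))
        where
        v = proj₁ (distinct i j i≢j)
        r = proj₁ (proj₂ (found j))
        s∈S : s i ∈ S
        s∈S = proj₁ (proj₂ (proj₂ (found i)))
        deg≡1 : deg F (s i) ≡ 1
        deg≡1 = defic-X _ (trans (cong (λ b → defic b (deg F (s i))) (≡-sym (S⊆X _ s∈S))) (inL⇒defic _ _ (factor (s i))))
        r∈Rj : r ∈ R j
        r∈Rj = proj₁ (proj₂ (proj₂ (proj₂ (found j))))
        r∈Ri : r ∈ R i
        r∈Ri = subst (_∈ R i)
          (count≡1⇒unique {P = edge F (s i)} deg≡1 (proj₂ (proj₂ (proj₂ (proj₂ (found i)))))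
            (subst (λ t → edge F t r ≡ true) (≡-sym eq) (proj₂ (proj₂ (proj₂ (proj₂ (found j)))))))
          (proj₁ (proj₂ (proj₂ (proj₂ (found i)))))
        forth : R i ⊆ R j
        forth = component-⊆ (proj₁ (comp i)) (proj₁ (comp j)) r∈Ri r∈Rj
        back : R j ⊆ R i
        back = component-⊆ (proj₁ (comp j)) (proj₁ (comp i)) r∈Rj r∈Ri
        agree : R i v ≡ R j v
        agree with ∈-or-∉ (R i) v
        ... | inj₁ v∈ = trans v∈ (≡-sym (forth v v∈))
        ... | inj₂ v∉ = trans v∉ (≡-sym (Bool.¬-not λ v∈ → ∈∉⇒⊥ (back v v∈) v∉))

theorem3p3 : ∀ {n : ℕ} (G : Graph n) (side : Fin n → Bool) →
    IsBipartition G side →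
    HasLFactor G side ⇔
    (∀ (S : Fin n → Bool) → (∀ v → S v ≡ true → side v ≡ true) →
    QAtMost G side S (count S))
theorem3p3 G side bip = mk⇔
  (λ (F , factor) S S⊆X → few-critical F factor S⊆X)
  factor-exists
  where open Critical G side bip
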